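{- Let $q$ be a prime power and let $r$ be an odd prime with $r\mid \frac{q-1}{2}$. Let $H_r^-$ be a cyclic subgroup of order $r$ of $G_q=\mathrm{PSL}(2,q)$ (such subgroups form a single conjugacy class). Then the intersection density of $G_q$ acting transitively by right multiplication on the right cosets of $H_r^-$ is at least $\frac{3r-1}{2r}$.
   Context: For a finite transitive permutation group $G\leq \mathrm{Sym}(\Omega)$, a subset $\mathcal{F}\subseteq G$ is intersecting if for all $g,h\in\mathcal{F}$ there is $\omega\in\Omega$ with $\omega^g=\omega^h$. The intersection density of $G$ is $\rho(G)=\max\{|\mathcal{F}| : \mathcal{F}\subseteq G \text{ intersecting}\}/(|G|/|\Omega|)$. -}

module Defs where

open import Data.Nat as ℕ using (ℕ; zero; suc)
open import Data.Fin as Fin using (Fin; toℕ)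
open import Data.Fin.Properties using (any?)
open import Data.List using (List; []; _∷_; length; map; concatMap; filter; deduplicate)
open import Data.List.Membership.Propositional using (_∈_)
open import Data.List.Relation.Unary.Unique.Propositional using (Unique)
open import Data.Product using (Σ; ∃; _×_; _,_)
open import Data.Sum using (_⊎_; inj₁; inj₂)
open import Relation.Binary.PropositionalEquality using (_≡_; _≢_; refl; cong)
open import Relation.Binary.Definitions using (DecidableEquality)
open import Relation.Nullary using (Dec; yes; no; ¬_)
open import Relation.Nullary.Decidable using (_⊎-dec_; _×-dec_)
open import Algebra.Structures using (IsCommutativeRing)

record FiniteField : Set₁ where
  infixl 7 _*_
  infixl 6 _+_
  field
    Carrier  : Set
    _+_ _*_  : Carrier → Carrier → Carrier
    -_       : Carrier → Carrier
    0# 1#    : Carrier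
    isCommutativeRing : IsCommutativeRing _≡_ _+_ _*_ -_ 0# 1#
    0≢1      : 0# ≢ 1#
    inverse  : ∀ x → x ≢ 0# → ∃ λ y → x * y ≡ 1#
    _≟_      : DecidableEquality Carrier
    elements : List Carrier
    elements-unique   : Unique elements
    elements-complete : ∀ x → x ∈ elements

  order : ℕ
  order = length elements

-- PSL(2,F), realised as SL(2,F) (2x2 matrices of determinant 1) modulo {±I}.
module PSL2 (F : FiniteField) where
  open FiniteField F

  record Mat : Set where
    constructor mat
    field a b c d : Carrier

  infixl 7 _·_
  _·_ : Mat → Mat → Mat
  mat a b c d · mat a' b' c' d' =
    mat (a * a' + b * c') (a * b' + b * d') (c * a' + d * c') (c * b' + d * d')

  det : Mat → Carrier
  det (mat a b c d) = a * d + - (b * c)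

  I : Mat
  I = mat 1# 0# 0# 1#

  neg : Mat → Mat
  neg (mat a b c d) = mat (- a) (- b) (- c) (- d)

  -- inverse of a determinant-1 matrix
  inv : Mat → Mat
  inv (mat a b c d) = mat d (- b) (- c) a

  pow : Mat → ℕ → Mat
  pow M zero    = I
  pow M (suc k) = M · pow M k

  _≟M_ : DecidableEquality Mat
  mat a b c d ≟M mat a' b' c' d' with a ≟ a' | b ≟ b' | c ≟ c' | d ≟ d'
  ... | yes refl | yes refl | yes refl | yes refl = yes refl
  ... | no p | _ | _ | _ = no λ { refl → p refl }
  ... | yes _ | no p | _ | _ = no λ { refl → p refl }
  ... | yes _ | yes _ | no p | _ = no λ { refl → p refl }
  ... | yes _ | yes _ | yes _ | no p = no λ { refl → p refl }

  _≈_ : Mat → Mat → Set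
  M ≈ N = (M ≡ N) ⊎ (M ≡ neg N)

  _≈?_ : (M N : Mat) → Dec (M ≈ N)
  M ≈? N = (M ≟M N) ⊎-dec (M ≟M neg N)

  allMats : List Mat
  allMats = concatMap (λ a → concatMap (λ b → concatMap (λ c →
              map (mat a b c) elements) elements) elements) elements

  SL : List Mat
  SL = filter (λ M → det M ≟ 1#) allMats

  |G| : ℕ
  |G| = length (deduplicate _≈?_ SL)

  HasOrder : Mat → ℕ → Set
  HasOrder h r = pow h r ≈ I × (∀ k → 0 ℕ.< k → k ℕ.< r → ¬ (pow h k ≈ I))

  -- Given h (of order r in PSL), H = ⟨h⟩ = { h^k : k < r } as a subset of PSL
  module Cosets (h : Mat) (r : ℕ) where
    InH : Mat → Set
    InH M = ∃ λ (k : Fin r) → M ≈ pow h (toℕ k)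

    InH? : (M : Mat) → Dec (InH M)
    InH? M = any? (λ k → M ≈? pow h (toℕ k))

    SameCoset : Mat → Mat → Set
    SameCoset x y = InH (x · inv y)

    SameCoset? : (x y : Mat) → Dec (SameCoset x y)
    SameCoset? x y = InH? (x · inv y)

    |Ω| : ℕ
    |Ω| = length (deduplicate SameCoset? SL)

    -- g and g' agree on some point ω = H x of Ω (right multiplication action:
    -- (H x)^g = H (x g))
    Intersect : Mat → Mat → Set
    Intersect g g' = ∃ λ x → x ∈ SL × SameCoset (x · g) (x · g')

{-# OPTIONS --safe #-}
module Submission where

-- Write r = 2n + 1.  Since r ∣ q - 1, the field contains all r-th roots of unity, and any
-- matrix of determinant 1 and trace l + l⁻¹ with l² ≠ 1 is conjugate in SL₂ to diag(l , l⁻¹).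
-- Since h² has order r and generates the same subgroup H as h, its trace is l + l⁻¹ for some l of
-- order r, so every matrix of trace lᵉ + l⁻ᵉ with lᵉ ≠ 1 is conjugate into H.  Two elements g, g′
-- intersect as soon as g g′⁻¹ is of this kind, which holds for any two of the 1 + 3n = (3r - 1) / 2
-- matrices
--
--   I,   ( l⁻ⁱ  0  )    ( lⁱ  l⁻ⁱ - lⁱ )    (    lⁱ      0  )
--        (  0   lⁱ ),   ( 0      l⁻ⁱ   ),   ( lⁱ - l⁻ⁱ  l⁻ⁱ )     with 1 ≤ i ≤ n,
--
-- since e is i - j within one of the three groups and i + j ≤ 2n < r across two of them.

open import Defs
open import Algebra.Bundles using (CommutativeRing; RawRing)
open import Data.Empty using (⊥-elim)
open import Data.Fin as Fin using (Fin; toℕ; fromℕ<; combine)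
import Data.Fin.Properties as Fin
open import Data.List using (List; []; _∷_; length; map; foldr; filter; replicate; _++_; applyUpTo; lookup
  ; deduplicate)
open import Data.List.Membership.Propositional using (_∈_; find; lose)
open import Data.List.Membership.Propositional.Properties
  using (∈-filter⁺; ∈-filter⁻; ∈-map⁺; ∈-map⁻; ∈-applyUpTo⁻; ∈-concatMap⁺; ∈-lookup; ∈-deduplicate⁻)
open import Data.List.Membership.Propositional.Properties.WithK using (unique∧set⇒bag)
open import Data.List.Properties using (length-++; length-replicate; length-applyUpTo)
open import Data.List.Relation.Binary.BagAndSetEquality using (∼bag⇒↭)
open import Data.List.Relation.Binary.Permutation.Propositional using (_↭_; ↭⇒↭ₛ)
open import Data.List.Relation.Binary.Permutation.Propositional.Properties using (↭-length)
import Data.List.Relation.Binary.Permutation.Setoid.Properties as Permutation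
open import Data.List.Relation.Unary.All as All using (All; []; _∷_)
import Data.List.Relation.Unary.All.Properties as All
open import Data.List.Relation.Unary.AllPairs using (AllPairs; []; _∷_)
import Data.List.Relation.Unary.AllPairs.Properties as AllPairs
open import Data.List.Relation.Unary.Any as Any using (Any; here; there; index)
import Data.List.Relation.Unary.Any.Properties as Any
import Data.List.Relation.Unary.Unique.DecSetoid.Properties as UniqueDecSetoid
open import Data.List.Relation.Unary.Unique.Propositional using (Unique)
import Data.List.Relation.Unary.Unique.Propositional.Properties as Unique
open import Data.Maybe.Base using (Maybe; just; nothing)
open import Data.Nat as ℕ using (ℕ; zero; suc; s≤s; z≤n)
open import Data.Nat.DivMod using (_%_; _/_; m≡m%n+[m/n]*n; m%n<n)
open import Data.Nat.Divisibility using (_∣_; divides; ∣⇒≤)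
open import Data.Nat.GCD using (gcd; gcd-GCD; gcd[m,n]∣m; gcd[m,n]∣n; module Bézout)
open import Data.Nat.Primality using (Prime; prime⇒irreducible; prime⇒nonTrivial; ¬prime[1])
import Data.Nat.Properties as ℕ
import Data.Nat.Solver as ℕ
open import Data.Product using (_×_; _,_; proj₁; proj₂; ∃; ∃₂)
open import Data.Sum using (_⊎_; inj₁; inj₂)
open import Function using (_∘_; mk⇔)
open import Level using (0ℓ)
open import Relation.Binary.Bundles using (DecSetoid)
open import Relation.Binary.PropositionalEquality
  using (_≡_; _≢_; refl; sym; trans; cong; cong₂; subst; module ≡-Reasoning)
import Relation.Binary.PropositionalEquality as ≡
open import Relation.Nullary using (yes; no; ¬_; contradiction)
open import Relation.Nullary.Decidable using (¬?; decidable-stable)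

-- The three groups come from three points of the projective line, spanned by the columns e₁ =
-- (1,0), e₂ = (0,1) and e₁ + e₂. The diagonal matrices fix e₁ and e₂, the upper ones e₁ and e₁ +
-- e₂, the lower ones e₁ + e₂ and e₂. The orientation is cyclic: at each point one of the two groups
-- fixing it acts with eigenvalue lⁱ and the other with l⁻ʲ. Hence g g′⁻¹ across two groups still
-- fixes the shared point, with eigenvalue l^(i+j) or its inverse, and determinant 1 then gives the
-- trace. With a non-cyclic orientation some pair of groups would yield i - j instead, which
-- vanishes at i = j. The other difficulty is that the eigenvalue l of h² must be found in the field
-- itself. No extension field is built: l is extracted from the periodicity of the entries of the
-- powers of h².

AllPairs-lookup-injective : ∀ {A : Set} {_∼_ : A → A → Set} → (∀ {x y} → x ∼ y → y ∼ x) →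
  ∀ {xs} → AllPairs (λ x y → ¬ x ∼ y) xs → ∀ i j → lookup xs i ∼ lookup xs j → i ≡ j
AllPairs-lookup-injective ∼-sym (x≁ ∷ ps) Fin.zero    Fin.zero    e = refl
AllPairs-lookup-injective ∼-sym (x≁ ∷ ps) Fin.zero    (Fin.suc j) e =
  contradiction e (All.lookup x≁ (∈-lookup j))
AllPairs-lookup-injective ∼-sym (x≁ ∷ ps) (Fin.suc i) Fin.zero    e =
  contradiction (∼-sym e) (All.lookup x≁ (∈-lookup i))
AllPairs-lookup-injective ∼-sym (x≁ ∷ ps) (Fin.suc i) (Fin.suc j) e =
  cong Fin.suc (AllPairs-lookup-injective ∼-sym ps i j e)

-- Used to bound the m + 2 coefficients of X^(m+1) - 1 by the number (m + 1) n of nonzero field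
-- elements.
1+m+1≤[1+m]*n : ∀ m {n} → 1 ℕ.< n → suc m ℕ.+ 1 ℕ.≤ suc m ℕ.* n
1+m+1≤[1+m]*n m {n} 1<n = begin
  suc m ℕ.+ 1             ≤⟨ ℕ.+-monoʳ-≤ (suc m) (s≤s z≤n) ⟩
  suc m ℕ.+ suc m         ≡⟨ cong (suc m ℕ.+_) (ℕ.*-identityˡ (suc m)) ⟨
  2 ℕ.* suc m             ≡⟨ ℕ.*-comm 2 (suc m) ⟩
  suc m ℕ.* 2             ≤⟨ ℕ.*-monoʳ-≤ (suc m) 1<n ⟩
  suc m ℕ.* n             ∎
  where open ℕ.≤-Reasoning

even-or-odd : ∀ n → 2 ∣ n ⊎ ∃ λ k → n ≡ suc (k ℕ.+ k)
even-or-odd zero    = inj₁ (divides 0 refl)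
even-or-odd (suc n) with even-or-odd n
... | inj₁ (divides k refl) = inj₂ (k , cong suc (trans (ℕ.*-comm k 2) (cong (k ℕ.+_) (ℕ.+-identityʳ k))))
... | inj₂ (k , refl)       = inj₁ (divides (suc k)
  (cong (suc ∘ suc) (trans (cong (k ℕ.+_) (sym (ℕ.+-identityʳ k))) (ℕ.*-comm 2 k))))

AllPairs-map-All : ∀ {A : Set} {P : A → Set} {R S : A → A → Set} → (∀ {x y} → P x → P y → R x y → S x y) →
  ∀ {xs} → All P xs → AllPairs R xs → AllPairs S xs
AllPairs-map-All f []       []         = []
AllPairs-map-All f (p ∷ ps) (rs ∷ rss) = All.zipWith (λ (q , r) → f p q r) (ps , rs) ∷ AllPairs-map-All f ps rss

-- For r = 2n + 1 one has 3r - 1 = 6n + 2 = 2s, so the density bound with denominators cleared is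
-- |G| ≤ |Ω| r multiplied by 2s.
density-arithmetic : ∀ n s G Ω → s ≡ suc (n ℕ.+ (n ℕ.+ n)) → G ℕ.≤ Ω ℕ.* suc (n ℕ.+ n) →
  (3 ℕ.* suc (n ℕ.+ n) ℕ.∸ 1) ℕ.* G ℕ.≤ s ℕ.* Ω ℕ.* (2 ℕ.* suc (n ℕ.+ n))
density-arithmetic n s G Ω refl G≤ = begin
  (3 ℕ.* suc (n ℕ.+ n) ℕ.∸ 1) ℕ.* G
    ≡⟨ cong (ℕ._* G) (solve 1 (λ n → n :+ n :+ (con 1 :+ (n :+ n) :+ (con 1 :+ (n :+ n) :+ con 0))
         := con 2 :* (con 1 :+ (n :+ (n :+ n)))) refl n) ⟩
  2 ℕ.* s ℕ.* G
    ≤⟨ ℕ.*-monoʳ-≤ (2 ℕ.* s) G≤ ⟩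
  2 ℕ.* s ℕ.* (Ω ℕ.* suc (n ℕ.+ n))
    ≡⟨ solve 3 (λ s w r → con 2 :* s :* (w :* r) := s :* w :* (con 2 :* r)) refl s Ω (suc (n ℕ.+ n)) ⟩
  s ℕ.* Ω ℕ.* (2 ℕ.* suc (n ℕ.+ n)) ∎
  where
  open ℕ.+-*-Solver
  open ℕ.≤-Reasoning

-- A ring solver with integer coefficients.

module FormalDifferenceSolver {c ℓ} (R : CommutativeRing c ℓ) where
  open CommutativeRing R renaming (refl to ≈-refl; sym to ≈-sym; trans to ≈-trans)
  open import Algebra.Solver.Ring.AlmostCommutativeRing
  open import Algebra.Properties.Semiring.Mult.TCOptimised semiring
    using (×-homo-+; ×1-homo-*) renaming (_×_ to _∙_)
  open import Algebra.Properties.Ring ring using (-0#≈0#; -‿involutive; -‿+-comm; -‿distribˡ-*; -‿distribʳ-*)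
  import Algebra.Solver.Ring as Solver
  open import Relation.Binary.Reasoning.Setoid setoid

  private
    target : AlmostCommutativeRing c ℓ
    target = fromCommutativeRing R

    -- A bootstrap solver that never recognises equal coefficients. It is called only for
    -- rearrangements in which nothing has to cancel.
    open Solver rawRing target (-raw-almostCommutative⟶ target) (λ _ _ → nothing)
      using (solve; _:=_; _:+_; _:*_; :-_)

  -- A pair (m , n) is the coefficient m - n.  Equality of coefficients is decidable, so the solver cancels
  -- opposite terms, which it could not do with coefficients in the abstract ring R.
  Difference : RawRing 0ℓ 0ℓ
  Difference = record
    { Carrier = ℕ × ℕ
    ; _≈_     = _≡_
    ; _+_     = λ (m , n) (m′ , n′) → m ℕ.+ m′ , n ℕ.+ n′
    ; _*_     = λ (m , n) (m′ , n′) → m ℕ.* m′ ℕ.+ n ℕ.* n′ , m ℕ.* n′ ℕ.+ n ℕ.* m′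
    ; -_      = λ (m , n) → n , m
    ; 0#      = 0 , 0
    ; 1#      = 1 , 0
    }

  -- The case split makes the values of (0 , 0) and (1 , 0) reduce to 0# and 1#.
  value : ℕ × ℕ → Carrier
  value (m , zero)      = m ∙ 1#
  value (m , n@(suc _)) = m ∙ 1# + - (n ∙ 1#)

  value≈ : ∀ m n → value (m , n) ≈ m ∙ 1# + - (n ∙ 1#)
  value≈ m zero    = ≈-sym (≈-trans (+-congˡ -0#≈0#) (+-identityʳ _))
  value≈ m (suc n) = ≈-refl

  value-+ : ∀ x y → value (RawRing._+_ Difference x y) ≈ value x + value y
  value-+ (m , n) (m′ , n′) = begin
    value (m ℕ.+ m′ , n ℕ.+ n′)
      ≈⟨ value≈ (m ℕ.+ m′) (n ℕ.+ n′) ⟩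
    (m ℕ.+ m′) ∙ 1# + - ((n ℕ.+ n′) ∙ 1#)
      ≈⟨ +-cong (×-homo-+ 1# m m′) (-‿cong (×-homo-+ 1# n n′)) ⟩
    (m ∙ 1# + m′ ∙ 1#) + - (n ∙ 1# + n′ ∙ 1#)
      ≈⟨ solve 4 (λ a b c d → (a :+ c) :+ (:- (b :+ d)) := (a :+ (:- b)) :+ (c :+ (:- d))) ≈-refl _ _ _ _ ⟩
    (m ∙ 1# + - (n ∙ 1#)) + (m′ ∙ 1# + - (n′ ∙ 1#))
      ≈⟨ +-cong (value≈ m n) (value≈ m′ n′) ⟨
    value (m , n) + value (m′ , n′) ∎

  value-* : ∀ x y → value (RawRing._*_ Difference x y) ≈ value x * value y
  value-* (m , n) (m′ , n′) = begin
    value (m ℕ.* m′ ℕ.+ n ℕ.* n′ , m ℕ.* n′ ℕ.+ n ℕ.* m′)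
      ≈⟨ value≈ (m ℕ.* m′ ℕ.+ n ℕ.* n′) (m ℕ.* n′ ℕ.+ n ℕ.* m′) ⟩
    (m ℕ.* m′ ℕ.+ n ℕ.* n′) ∙ 1# + - ((m ℕ.* n′ ℕ.+ n ℕ.* m′) ∙ 1#)
      ≈⟨ +-cong (expand m m′ n n′) (-‿cong (expand m n′ n m′)) ⟩
    (m ∙ 1# * (m′ ∙ 1#) + n ∙ 1# * (n′ ∙ 1#)) + - (m ∙ 1# * (n′ ∙ 1#) + n ∙ 1# * (m′ ∙ 1#))
      ≈⟨ +-cong (+-congˡ (≈-trans (≈-sym (-‿involutive _)) (≈-trans (-‿cong (-‿distribˡ-* _ _)) (-‿distribʳ-* _ _))))
               (≈-trans (≈-sym (-‿+-comm _ _)) (+-cong (-‿distribʳ-* _ _) (-‿distribˡ-* _ _))) ⟩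
    (m ∙ 1# * (m′ ∙ 1#) + - (n ∙ 1#) * - (n′ ∙ 1#)) + (m ∙ 1# * - (n′ ∙ 1#) + - (n ∙ 1#) * (m′ ∙ 1#))
      ≈⟨ solve 4 (λ a b c d → (a :* c :+ b :* d) :+ (a :* d :+ b :* c) := (a :+ b) :* (c :+ d)) ≈-refl _ _ _ _ ⟩
    (m ∙ 1# + - (n ∙ 1#)) * (m′ ∙ 1# + - (n′ ∙ 1#))
      ≈⟨ *-cong (value≈ m n) (value≈ m′ n′) ⟨
    value (m , n) * value (m′ , n′) ∎
    where
    expand : ∀ a b c d → (a ℕ.* b ℕ.+ c ℕ.* d) ∙ 1# ≈ a ∙ 1# * (b ∙ 1#) + c ∙ 1# * (d ∙ 1#)
    expand a b c d = ≈-trans (×-homo-+ 1# (a ℕ.* b) (c ℕ.* d)) (+-cong (×1-homo-* a b) (×1-homo-* c d))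

  value-neg : ∀ x → value (RawRing.-_ Difference x) ≈ - value x
  value-neg (m , n) = begin
    value (n , m)             ≈⟨ value≈ n m ⟩
    n ∙ 1# + - (m ∙ 1#)       ≈⟨ +-comm _ _ ⟩
    - (m ∙ 1#) + n ∙ 1#       ≈⟨ +-congˡ (-‿involutive _) ⟨
    - (m ∙ 1#) + - - (n ∙ 1#) ≈⟨ -‿+-comm _ _ ⟩
    - (m ∙ 1# + - (n ∙ 1#))   ≈⟨ -‿cong (value≈ m n) ⟨
    - value (m , n)           ∎

  -- Adding d - d, using the crosswise equality of the two sums, then dropping b - b. Both
  -- cancellations are done by hand, being beyond the bootstrap solver.
  value-≡ : ∀ m n m′ n′ → m ℕ.+ n′ ≡ m′ ℕ.+ n → value (m , n) ≈ value (m′ , n′)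
  value-≡ m n m′ n′ eq = begin
    value (m , n)                    ≈⟨ value≈ m n ⟩
    a + - b                          ≈⟨ +-identityʳ _ ⟨
    (a + - b) + 0#                   ≈⟨ +-congˡ (-‿inverseʳ d) ⟨
    (a + - b) + (d + - d)
      ≈⟨ solve 3 (λ a b d → (a :+ (:- b)) :+ (d :+ (:- d))
           := (a :+ d) :+ (:- b :+ (:- d))) ≈-refl a b d ⟩
    (a + d) + (- b + - d)
      ≈⟨ +-congʳ (≈-trans (≈-sym (×-homo-+ 1# m n′)) (≈-trans (reflexive (cong (_∙ 1#) eq)) (×-homo-+ 1# m′ n))) ⟩
    (c′ + b) + (- b + - d)
      ≈⟨ solve 3 (λ c b d → (c :+ b) :+ (:- b :+ (:- d))
           := (c :+ (:- d)) :+ (b :+ (:- b))) ≈-refl c′ b d ⟩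
    (c′ + - d) + (b + - b)           ≈⟨ +-congˡ (-‿inverseʳ b) ⟩
    (c′ + - d) + 0#                  ≈⟨ +-identityʳ _ ⟩
    c′ + - d                         ≈⟨ value≈ m′ n′ ⟨
    value (m′ , n′)                  ∎
    where
    a = m ∙ 1#
    b = n ∙ 1#
    c′ = m′ ∙ 1#
    d = n′ ∙ 1#

  value-homomorphism : Difference -Raw-AlmostCommutative⟶ target
  value-homomorphism = record
    { ⟦_⟧    = value
    ; +-homo = value-+
    ; *-homo = value-*
    ; -‿homo = value-neg
    ; 0-homo = ≈-refl
    ; 1-homo = ≈-refl
    }

  value-equal? : ∀ x y → Maybe (value x ≈ value y)
  value-equal? (m , n) (m′ , n′) with m ℕ.+ n′ ℕ.≟ m′ ℕ.+ n
  ... | yes eq = just (value-≡ m n m′ n′ eq)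
  ... | no _   = nothing

  open Solver Difference target value-homomorphism value-equal? public

-- Finite fields: Fermat's theorem, roots of polynomials, roots of unity, linear recurrences.

module FieldTheory (F : FiniteField) where
  open FiniteField F renaming (_≟_ to infix 4 _≟_)

  commutativeRing : CommutativeRing 0ℓ 0ℓ
  commutativeRing = record { isCommutativeRing = isCommutativeRing }

  open CommutativeRing commutativeRing public
    using (*-identityˡ; *-identityʳ; *-comm; *-assoc; zeroˡ; zeroʳ; +-identityˡ; +-identityʳ; -‿inverseˡ; -‿inverseʳ
          ; *-isCommutativeMonoid; ring; commutativeSemiring)
  open import Algebra.Properties.CommutativeSemiring.Exp commutativeSemiring public
  open import Algebra.Properties.Ring ring public using (-0#≈0#; -‿involutive; x∙y⁻¹≈ε⇒x≈y; +-cancelʳ)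
  open FormalDifferenceSolver commutativeRing public

  open ≡-Reasoning

  :1 : ∀ {n} → Polynomial n
  :1 = con (1 , 0)

  :0 : ∀ {n} → Polynomial n
  :0 = con (0 , 0)

  *-zero-divisor : ∀ x y → x * y ≡ 0# → x ≢ 0# → y ≡ 0#
  *-zero-divisor x y xy≡0 x≢0 with z , xz≡1 ← inverse x x≢0 = begin
    y           ≡⟨ *-identityˡ y ⟨
    1# * y      ≡⟨ cong (_* y) xz≡1 ⟨
    x * z * y   ≡⟨ solve 3 (λ x y z → x :* z :* y := z :* (x :* y)) refl x y z ⟩
    z * (x * y) ≡⟨ cong (z *_) xy≡0 ⟩
    z * 0#      ≡⟨ zeroʳ z ⟩
    0#          ∎

  *-≢0 : ∀ {x y} → x ≢ 0# → y ≢ 0# → x * y ≢ 0#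
  *-≢0 x≢0 y≢0 xy≡0 = y≢0 (*-zero-divisor _ _ xy≡0 x≢0)

  x-y≢0 : ∀ {x y} → x ≢ y → x + - y ≢ 0#
  x-y≢0 x≢y = x≢y ∘ x∙y⁻¹≈ε⇒x≈y _ _

  *-cancelˡ : ∀ x y z → x ≢ 0# → x * y ≡ x * z → y ≡ z
  *-cancelˡ x y z x≢0 eq = x∙y⁻¹≈ε⇒x≈y y z (*-zero-divisor x _ (begin
    x * (y + - z)     ≡⟨ solve 3 (λ x y z → x :* (y :+ :- z) := x :* y :+ :- (x :* z)) refl x y z ⟩
    x * y + - (x * z) ≡⟨ cong (λ w → w + - (x * z)) eq ⟩
    x * z + - (x * z) ≡⟨ -‿inverseʳ _ ⟩
    0#                ∎) x≢0)

  ^-≢0 : ∀ {x} n → x ≢ 0# → x ^ n ≢ 0#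
  ^-≢0 zero    x≢0 = 0≢1 ∘ sym
  ^-≢0 (suc n) x≢0 = *-≢0 x≢0 (^-≢0 n x≢0)

  1^ : ∀ n → 1# ^ n ≡ 1#
  1^ zero    = refl
  1^ (suc n) = trans (*-identityˡ _) (1^ n)

  nonzeros : List Carrier
  nonzeros = filter (λ x → ¬? (x ≟ 0#)) elements

  ∈-nonzeros⁺ : ∀ {x} → x ≢ 0# → x ∈ nonzeros
  ∈-nonzeros⁺ x≢0 = ∈-filter⁺ (λ x → ¬? (x ≟ 0#)) (elements-complete _) x≢0

  ∈-nonzeros⁻ : ∀ {x} → x ∈ nonzeros → x ≢ 0#
  ∈-nonzeros⁻ x∈ = proj₂ (∈-filter⁻ (λ x → ¬? (x ≟ 0#)) {xs = elements} x∈)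

  nonzeros-unique : Unique nonzeros
  nonzeros-unique = Unique.filter⁺ (λ x → ¬? (x ≟ 0#)) elements-unique

  -- Duplicate-free lists with the same members are permutations of each other. This serves to count
  -- the nonzero elements.
  elements↭0∷nonzeros : elements ↭ 0# ∷ nonzeros
  elements↭0∷nonzeros = ∼bag⇒↭ (unique∧set⇒bag elements-unique
    (All.tabulate (λ x∈ 0≡x → ∈-nonzeros⁻ x∈ (sym 0≡x)) ∷ nonzeros-unique)
    (mk⇔ (λ _ → split _) (λ _ → elements-complete _)))
    where
    split : ∀ x → x ∈ 0# ∷ nonzeros
    split x with x ≟ 0#
    ... | yes x≡0 = here x≡0
    ... | no  x≢0 = there (∈-nonzeros⁺ x≢0)

  length-nonzeros : length nonzeros ≡ order ℕ.∸ 1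
  length-nonzeros = cong (ℕ._∸ 1) (sym (↭-length elements↭0∷nonzeros))

  *-permutes-nonzeros : ∀ {x} → x ≢ 0# → map (x *_) nonzeros ↭ nonzeros
  *-permutes-nonzeros {x} x≢0 = ∼bag⇒↭ (unique∧set⇒bag
    (Unique.map⁺ (*-cancelˡ x _ _ x≢0) nonzeros-unique) nonzeros-unique (mk⇔ to from))
    where
    to : ∀ {y} → y ∈ map (x *_) nonzeros → y ∈ nonzeros
    to y∈ with z , z∈ , refl ← ∈-map⁻ (x *_) y∈ = ∈-nonzeros⁺ (*-≢0 x≢0 (∈-nonzeros⁻ z∈))
    from : ∀ {y} → y ∈ nonzeros → y ∈ map (x *_) nonzeros
    from {y} y∈ with z , xz≡1 ← inverse x x≢0 =
      subst (_∈ map (x *_) nonzeros) x[zy]≡y (∈-map⁺ (x *_) (∈-nonzeros⁺ zy≢0))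
      where
      x[zy]≡y : x * (z * y) ≡ y
      x[zy]≡y = trans (sym (*-assoc x z y)) (trans (cong (_* y) xz≡1) (*-identityˡ y))
      zy≢0 : z * y ≢ 0#
      zy≢0 zy≡0 = ∈-nonzeros⁻ y∈ (trans (sym x[zy]≡y) (trans (cong (x *_) zy≡0) (zeroʳ x)))

  product : List Carrier → Carrier
  product = foldr _*_ 1#

  product-map-* : ∀ x ys → product (map (x *_) ys) ≡ x ^ length ys * product ys
  product-map-* x []       = sym (*-identityˡ 1#)
  product-map-* x (y ∷ ys) = begin
    x * y * product (map (x *_) ys)         ≡⟨ cong (x * y *_) (product-map-* x ys) ⟩
    x * y * (x ^ length ys * product ys)
      ≡⟨ solve 4 (λ x y z w → x :* y :* (z :* w)
           := x :* z :* (y :* w)) refl x y _ _ ⟩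
    x * x ^ length ys * (y * product ys)    ∎

  product-≢0 : ∀ {xs} → All (_≢ 0#) xs → product xs ≢ 0#
  product-≢0 []          = 0≢1 ∘ sym
  product-≢0 (x≢0 ∷ pxs) = *-≢0 x≢0 (product-≢0 pxs)

  -- Multiplication by x permutes the nonzero elements, so their product P satisfies x^(order - 1) P
  -- = P, and P ≠ 0 cancels.
  fermat : ∀ {x} → x ≢ 0# → x ^ (order ℕ.∸ 1) ≡ 1#
  fermat {x} x≢0 = *-cancelˡ P _ _ (product-≢0 (All.tabulate ∈-nonzeros⁻)) (begin
    P * x ^ (order ℕ.∸ 1)             ≡⟨ *-comm P _ ⟩
    x ^ (order ℕ.∸ 1) * P             ≡⟨ cong (λ n → x ^ n * P) length-nonzeros ⟨
    x ^ length nonzeros * P           ≡⟨ product-map-* x nonzeros ⟨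
    product (map (x *_) nonzeros)     ≡⟨ Permutation.foldr-commMonoid (≡.setoid Carrier) *-isCommutativeMonoid
                                           (↭⇒↭ₛ (*-permutes-nonzeros x≢0)) ⟩
    P                                 ≡⟨ *-identityʳ P ⟨
    P * 1#                            ∎)
    where
    P = product nonzeros

  -- Polynomials as coefficient lists, constant term first.

  eval : List Carrier → Carrier → Carrier
  eval []      x = 0#
  eval (a ∷ p) x = a + x * eval p x

  -- The coefficients of (a + X p(X) - a - y p(y)) / (X - y).
  quotient : Carrier → List Carrier → List Carrier
  quotient y []      = []
  quotient y (a ∷ p) = eval (a ∷ p) y ∷ quotient y p

  eval-quotient : ∀ y a p x → eval (a ∷ p) x ≡ eval (a ∷ p) y + (x + - y) * eval (quotient y p) x
  eval-quotient y a []      x =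
    solve 3 (λ x y a → a :+ x :* :0 := a :+ y :* :0 :+ (x :+ :- y) :* :0) refl x y a
  eval-quotient y a (b ∷ p) x = begin
    a + x * eval (b ∷ p) x               ≡⟨ cong (λ w → a + x * w) (eval-quotient y b p x) ⟩
    a + x * (v + (x + - y) * q)          ≡⟨ solve 5 (λ x y a v q → a :+ x :* (v :+ (x :+ :- y) :* q)
                                              := a :+ y :* v :+ (x :+ :- y) :* (v :+ x :* q)) refl x y a v q ⟩
    a + y * v + (x + - y) * (v + x * q)  ∎
    where
    v = eval (b ∷ p) y
    q = eval (quotient y p) x

  length-quotient : ∀ y p → length (quotient y p) ≡ length p
  length-quotient y []      = refl
  length-quotient y (a ∷ p) = cong suc (length-quotient y p)

  eval-zeros : ∀ {p} x → All (_≡ 0#) p → eval p x ≡ 0#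
  eval-zeros x []           = refl
  eval-zeros x (refl ∷ ps) = trans (+-identityˡ _) (trans (cong (x *_) (eval-zeros x ps)) (zeroʳ x))

  constant-term : ∀ {a p} x → eval (a ∷ p) x ≡ 0# → All (_≡ 0#) p → a ≡ 0#
  constant-term {a} {p} x root ps = begin
    a                 ≡⟨ +-identityʳ a ⟨
    a + 0#            ≡⟨ cong (a +_) (zeroʳ x) ⟨
    a + x * 0#        ≡⟨ cong (λ w → a + x * w) (eval-zeros x ps) ⟨
    a + x * eval p x  ≡⟨ root ⟩
    0#                ∎

  quotient-zero : ∀ y p → All (_≡ 0#) (quotient y p) → All (_≡ 0#) p
  quotient-zero y []      []       = []
  quotient-zero y (a ∷ p) (e ∷ qs) = constant-term y e ps ∷ ps
    where ps = quotient-zero y p qs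

  -- Dividing by X - y for the first root y leaves a quotient that vanishes at the other roots,
  -- since x - y ≠ 0 there. By induction the quotient is zero, which kills every coefficient but the
  -- constant one, and the root y kills that one. Measuring `p` by its number of coefficients, one
  -- more than a degree bound, avoids any talk of leading coefficients.
  too-many-roots : ∀ p {xs} → Unique xs → All (λ x → eval p x ≡ 0#) xs →
                   length p ℕ.≤ length xs → All (_≡ 0#) p
  too-many-roots []      _ _ _ = []
  too-many-roots (a ∷ p) {y ∷ xs} (y∉xs ∷ xs!) (root ∷ roots) (s≤s len) = constant-term y root ps ∷ ps
    where
    quotient-root : ∀ {x} → y ≢ x × eval (a ∷ p) x ≡ 0# → eval (quotient y p) x ≡ 0#
    quotient-root {x} (y≢x , rx) = *-zero-divisor (x + - y) _ (begin
      (x + - y) * eval (quotient y p) x                      ≡⟨ +-identityˡ _ ⟨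
      0# + (x + - y) * eval (quotient y p) x                 ≡⟨ cong (_+ ((x + - y) * eval (quotient y p) x)) root ⟨
      eval (a ∷ p) y + (x + - y) * eval (quotient y p) x     ≡⟨ eval-quotient y a p x ⟨
      eval (a ∷ p) x                                         ≡⟨ rx ⟩
      0#                                                     ∎) (x-y≢0 (y≢x ∘ sym))
    ps : All (_≡ 0#) p
    ps = quotient-zero y p (too-many-roots (quotient y p) xs!
           (All.zipWith quotient-root (y∉xs , roots))
           (subst (ℕ._≤ length xs) (sym (length-quotient y p)) len))

  eval-monomial : ∀ n x → eval (replicate n 0# ++ 1# ∷ []) x ≡ x ^ n
  eval-monomial zero    x = trans (cong (1# +_) (zeroʳ x)) (+-identityʳ 1#)
  eval-monomial (suc n) x = trans (+-identityˡ _) (cong (x *_) (eval-monomial n x))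

  -- X^m - 1 has at most m roots, fewer than the m n nonzero elements, so some x has x^m ≠ 1. Then ζ
  -- = x^m works by `fermat`.
  nontrivial-root-of-unity : ∀ n m → order ℕ.∸ 1 ≡ m ℕ.* n → 1 ℕ.< n →
                             ∃ λ ζ → ζ ^ n ≡ 1# × ζ ≢ 1#
  nontrivial-root-of-unity n zero eq 1<n
    with nonzeros | ∈-nonzeros⁺ {1#} (0≢1 ∘ sym) | trans length-nonzeros eq
  ... | _ ∷ _ | _ | ()
  nontrivial-root-of-unity n (suc m) eq 1<n
    with All.all? (λ x → x ^ suc m ≟ 1#) nonzeros
  ... | no ¬all with x , x∈ , ≢1 ← find (All.¬All⇒Any¬ (λ x → x ^ suc m ≟ 1#) nonzeros ¬all)
    = x ^ suc m , trans (^-assocʳ x (suc m) n) (trans (cong (x ^_) (sym eq)) (fermat (∈-nonzeros⁻ x∈))) , ≢1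
  ... | yes all = ⊥-elim (0≢1 (begin
      0#        ≡⟨ -0#≈0# ⟨
      - 0#      ≡⟨ cong -_ (All.head (too-many-roots p nonzeros-unique (All.map root all) len)) ⟨
      - - 1#    ≡⟨ -‿involutive 1# ⟩
      1#        ∎))
    where
    p = - 1# ∷ replicate m 0# ++ 1# ∷ []
    root : ∀ {x} → x ^ suc m ≡ 1# → eval p x ≡ 0#
    root {x} e = trans (cong (λ w → - 1# + x * w) (eval-monomial m x))
                (trans (cong (- 1# +_) e) (-‿inverseˡ 1#))
    len : length p ℕ.≤ length nonzeros
    len = ℕ.≤-trans
      (ℕ.≤-reflexive (cong suc (trans (length-++ (replicate m 0#)) (cong (ℕ._+ 1) (length-replicate m)))))
      (ℕ.≤-trans (1+m+1≤[1+m]*n m 1<n) (ℕ.≤-reflexive (sym (trans length-nonzeros eq))))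

  ^-∣ : ∀ {x n k} → x ^ n ≡ 1# → n ∣ k → x ^ k ≡ 1#
  ^-∣ {x} {n} e (divides m refl) = trans (cong (x ^_) (ℕ.*-comm m n))
    (trans (sym (^-assocʳ x n m)) (trans (^-congˡ m e) (1^ m)))

  -- With natural exponents Bézout's identity has two forms, gcd + b n = a m and gcd + a m = b n. In
  -- either one the powers other than x^gcd are 1.
  ^-gcd : ∀ {x} m n → x ^ m ≡ 1# → x ^ n ≡ 1# → x ^ gcd m n ≡ 1#
  ^-gcd {x} m n em en with Bézout.identity (gcd-GCD m n)
  ... | Bézout.+- a b eq = begin
    x ^ gcd m n                  ≡⟨ *-identityʳ _ ⟨
    x ^ gcd m n * 1#             ≡⟨ cong (_ *_) (^-∣ en (divides b refl)) ⟨
    x ^ gcd m n * x ^ (b ℕ.* n)  ≡⟨ ^-homo-* x (gcd m n) (b ℕ.* n) ⟨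
    x ^ (gcd m n ℕ.+ b ℕ.* n)    ≡⟨ cong (x ^_) eq ⟩
    x ^ (a ℕ.* m)                ≡⟨ ^-∣ em (divides a refl) ⟩
    1#                           ∎
  ... | Bézout.-+ a b eq = begin
    x ^ gcd m n                  ≡⟨ *-identityʳ _ ⟨
    x ^ gcd m n * 1#             ≡⟨ cong (_ *_) (^-∣ em (divides a refl)) ⟨
    x ^ gcd m n * x ^ (a ℕ.* m)  ≡⟨ ^-homo-* x (gcd m n) (a ℕ.* m) ⟨
    x ^ (gcd m n ℕ.+ a ℕ.* m)    ≡⟨ cong (x ^_) eq ⟩
    x ^ (b ℕ.* n)                ≡⟨ ^-∣ en (divides b refl) ⟩
    1#                           ∎

  prime-order : ∀ {x p k} → Prime p → x ^ p ≡ 1# → x ≢ 1# → x ^ k ≡ 1# → p ∣ k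
  prime-order {x} {p} {k} pp ep x≢1 ek with prime⇒irreducible pp (gcd[m,n]∣m p k)
  ... | inj₁ gcd≡1 = contradiction
    (trans (sym (*-identityʳ x)) (trans (cong (x ^_) (sym gcd≡1)) (^-gcd p k ep ek))) x≢1
  ... | inj₂ gcd≡p = subst (_∣ k) gcd≡p (gcd[m,n]∣n p k)

  unit-root≢0 : ∀ {x n} → 0 ℕ.< n → x ^ n ≡ 1# → x ≢ 0#
  unit-root≢0 {n = suc n} _ e refl = 0≢1 (trans (sym (zeroˡ _)) e)

  -- Cancelling xⁱ would leave x^(j-i) = 1 with 0 < j - i < p, so p would divide a smaller positive
  -- number.
  ^-injective-< : ∀ {x p i j} → Prime p → x ^ p ≡ 1# → x ≢ 1# → i ℕ.< j → j ℕ.< p → x ^ i ≢ x ^ j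
  ^-injective-< {x} {p} {i} {j} pp ep x≢1 i<j j<p eq =
    ℕ.<⇒≱ (ℕ.≤-<-trans (ℕ.m∸n≤m j i) j<p) (∣⇒≤ ⦃ ℕ.>-nonZero (ℕ.m<n⇒0<n∸m i<j) ⦄ (prime-order pp ep x≢1 (sym
      (*-cancelˡ (x ^ i) 1# (x ^ (j ℕ.∸ i)) (^-≢0 i x≢0) (begin
        x ^ i * 1#              ≡⟨ *-identityʳ _ ⟩
        x ^ i                   ≡⟨ eq ⟩
        x ^ j                   ≡⟨ cong (x ^_) (ℕ.m+[n∸m]≡n (ℕ.<⇒≤ i<j)) ⟨
        x ^ (i ℕ.+ (j ℕ.∸ i))   ≡⟨ ^-homo-* x i (j ℕ.∸ i) ⟩
        x ^ i * x ^ (j ℕ.∸ i)   ∎)))))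
    where
    x≢0 = unit-root≢0 (ℕ.≤-<-trans z≤n j<p) ep

  -- Both sides are the sum of s k xᵏ over 0 ≤ k ≤ n, split off at the bottom term on the left and
  -- at the top term on the right.
  eval-shift : ∀ s n x → x * eval (applyUpTo (s ∘ suc) n) x + s 0 ≡ eval (applyUpTo s n) x + x ^ n * s n
  eval-shift s zero x = solve 2 (λ x s → x :* :0 :+ s := :0 :+ :1 :* s) refl x (s 0)
  eval-shift s (suc n) x = begin
    x * (s 1 + x * E) + s 0
      ≡⟨ solve 4 (λ x a b e → x :* (b :+ x :* e) :+ a
           := a :+ x :* (x :* e :+ b)) refl x (s 0) (s 1) E ⟩
    s 0 + x * (x * E + s 1)            ≡⟨ cong (λ w → s 0 + x * w) (eval-shift (s ∘ suc) n x) ⟩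
    s 0 + x * (E′ + x ^ n * s (suc n))
      ≡⟨ solve 5 (λ x a e p b → a :+ x :* (e :+ p :* b)
           := (a :+ x :* e) :+ x :* p :* b) refl x (s 0) E′ (x ^ n) (s (suc n)) ⟩
    s 0 + x * E′ + x * x ^ n * s (suc n) ∎
    where
    E = eval (applyUpTo (s ∘ suc ∘ suc) n) x
    E′ = eval (applyUpTo (s ∘ suc) n) x

  eval-recurrence : ∀ t s n x → (∀ k → s (2 ℕ.+ k) ≡ t * s (suc k) + - s k) →
    eval (applyUpTo (s ∘ suc ∘ suc) n) x ≡ t * eval (applyUpTo (s ∘ suc) n) x + - eval (applyUpTo s n) x
  eval-recurrence t s zero    x rec = solve 1 (λ t → :0 := t :* :0 :+ :- :0) refl t
  eval-recurrence t s (suc n) x rec = trans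
    (cong₂ (λ v w → v + x * w) (rec 0) (eval-recurrence t (s ∘ suc) n x (rec ∘ suc)))
    (solve 6 (λ t x a b c d → t :* a :+ :- b :+ x :* (t :* c :+ :- d) := t :* (a :+ x :* c) :+ :- (b :+ x :* d))
      refl t x _ _ _ _)

  eval-telescope : ∀ u n → eval (applyUpTo (λ k → u (suc k) + - u k) n) 1# + u 0 ≡ u n
  eval-telescope u zero    = +-identityˡ _
  eval-telescope u (suc n) = trans
    (solve 3 (λ a b e → b :+ :- a :+ :1 :* e :+ a := e :+ b) refl (u 0) (u 1) _)
    (eval-telescope (u ∘ suc) n)

  -- Put s k = u (k + 1) - u k and P(x) = Σ_{k < p} s k xᵏ.  For xᵖ = 1, shifting the periodic sequence s
  -- gives P(x) (1 - t x + x²) = 0; P(1) telescopes to 0; and P, having at most p coefficients that are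
  -- not all 0, cannot vanish at all p powers of ζ.
  characteristic-root : ∀ {p ζ} → Prime p → ζ ^ p ≡ 1# → ζ ≢ 1# → ∀ t u →
    (∀ k → u (2 ℕ.+ k) ≡ t * u (suc k) + - u k) → u p ≡ u 0 → u (suc p) ≡ u 1 → u 1 ≢ u 0 →
    ∃ λ x → x ^ p ≡ 1# × x ≢ 1# × t * x ≡ 1# + x * x
  characteristic-root {p} {ζ} pp ζ^p ζ≢1 t u rec up up₁ u₁≢u₀
    with All.all? (λ x → eval (applyUpTo (λ k → u (suc k) + - u k) p) x ≟ 0#) (applyUpTo (ζ ^_) p)
  ... | yes all = ⊥-elim (x-y≢0 u₁≢u₀ (first p (λ k → u (suc k) + - u k) 0<p
        (too-many-roots _ (AllPairs.applyUpTo⁺₁ (ζ ^_) p (^-injective-< pp ζ^p ζ≢1)) all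
        (ℕ.≤-reflexive (trans (length-applyUpTo _ p) (sym (length-applyUpTo (ζ ^_) p)))))))
    where
    0<p : 0 ℕ.< p
    0<p = ℕ.>-nonZero⁻¹ p ⦃ ℕ.nonTrivial⇒nonZero p ⦃ prime⇒nonTrivial pp ⦄ ⦄
    first : ∀ n s → 0 ℕ.< n → All (_≡ 0#) (applyUpTo s n) → s 0 ≡ 0#
    first (suc n) s _ (e ∷ _) = e
  ... | no ¬all
    with y , y∈ , P≢0 ← find (All.¬All⇒Any¬ (λ x → eval (applyUpTo (λ k → u (suc k) + - u k) p) x ≟ 0#) _ ¬all)
    with i , _ , refl ← ∈-applyUpTo⁻ (ζ ^_) y∈
    = y , y^p , y≢1 , *-cancelˡ P₀ _ _ P≢0 (begin
      P₀ * (t * y)                ≡⟨ solve 3 (λ P t y → P :* (t :* y) := t :* y :* P) refl P₀ t y ⟩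
      t * y * P₀                  ≡⟨ cong (t * y *_) (shift s s-period) ⟨
      t * y * (y * P₁)            ≡⟨ solve 4 (λ t y P₁ P₀ → t :* y :* (y :* P₁)
                                       := y :* (y :* (t :* P₁ :+ :- P₀)) :+ y :* y :* P₀) refl t y P₁ P₀ ⟩
      y * (y * (t * P₁ + - P₀)) + y * y * P₀
                                  ≡⟨ cong (λ w → y * (y * w) + y * y * P₀) (eval-recurrence t s p y s-rec) ⟨
      y * (y * P₂) + y * y * P₀   ≡⟨ cong (λ w → y * w + y * y * P₀) (shift (s ∘ suc) s-period₁) ⟩
      y * P₁ + y * y * P₀         ≡⟨ cong (_+ y * y * P₀) (shift s s-period) ⟩
      P₀ + y * y * P₀             ≡⟨ solve 2 (λ P y → P :+ y :* y :* P := P :* (:1 :+ y :* y)) refl P₀ y ⟩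
      P₀ * (1# + y * y)           ∎)
    where
    s : ℕ → Carrier
    s k = u (suc k) + - u k
    P₀ P₁ P₂ : Carrier
    P₀ = eval (applyUpTo s p) y
    P₁ = eval (applyUpTo (s ∘ suc) p) y
    P₂ = eval (applyUpTo (s ∘ suc ∘ suc) p) y
    y^p : y ^ p ≡ 1#
    y^p = trans (^-assocʳ ζ i p) (^-∣ ζ^p (divides i refl))
    s-rec : ∀ k → s (2 ℕ.+ k) ≡ t * s (suc k) + - s k
    s-rec k = trans (cong₂ (λ v w → v + - w) (rec (suc k)) (rec k))
      (solve 4 (λ t a b c → t :* a :+ :- b :+ :- (t :* b :+ :- c) := t :* (a :+ :- b) :+ :- (b :+ :- c)) refl t _ _ _)
    s-period : s p ≡ s 0
    s-period = cong₂ (λ v w → v + - w) up₁ up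
    s-period₁ : s (suc p) ≡ s 1
    s-period₁ = cong₂ (λ v w → v + - w)
      (trans (rec p) (trans (cong₂ (λ v w → t * v + - w) up₁ up) (sym (rec 0)))) up₁
    shift : ∀ f → f p ≡ f 0 → y * eval (applyUpTo (f ∘ suc) p) y ≡ eval (applyUpTo f p) y
    shift f fp = +-cancelʳ (f 0) _ _ (trans (eval-shift f p y)
      (cong (eval (applyUpTo f p) y +_) (trans (cong₂ _*_ y^p fp) (*-identityˡ _))))
    y≢1 : y ≢ 1#
    y≢1 y≡1 = P≢0 (trans (cong (eval (applyUpTo s p)) y≡1)
      (+-cancelʳ (u 0) _ _ (trans (eval-telescope u p) (trans up (sym (+-identityˡ _))))))

-- Matrices of determinant 1 and their conjugation.

module PSL2Theory (F : FiniteField) where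
  open FiniteField F renaming (_≟_ to infix 4 _≟_)
  open FieldTheory F
  open PSL2 F renaming (_≈_ to infix 4 _≈_)
  open ≡-Reasoning

  mat-cong : ∀ {a b c d a′ b′ c′ d′} → a ≡ a′ → b ≡ b′ → c ≡ c′ → d ≡ d′ → mat a b c d ≡ mat a′ b′ c′ d′
  mat-cong refl refl refl refl = refl

  diag : Carrier → Carrier → Mat
  diag u v = mat u 0# 0# v

  trace : Mat → Carrier
  trace (mat a b c d) = a + d

  ·-assoc : ∀ M N P → (M · N) · P ≡ M · (N · P)
  ·-assoc (mat a b c d) (mat e f g h) (mat i j k l) =
    mat-cong (entry a b i k) (entry a b j l) (entry c d i k) (entry c d j l)
    where
    entry : ∀ x y z w → (x * e + y * g) * z + (x * f + y * h) * w ≡ x * (e * z + f * w) + y * (g * z + h * w)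
    entry x y z w = solve 8 (λ x y z w e f g h →
      (x :* e :+ y :* g) :* z :+ (x :* f :+ y :* h) :* w := x :* (e :* z :+ f :* w) :+ y :* (g :* z :+ h :* w))
      refl x y z w e f g h

  ·-identityˡ : ∀ M → I · M ≡ M
  ·-identityˡ (mat a b c d) = mat-cong (top a c) (top b d) (bottom a c) (bottom b d)
    where
    top    = solve 2 (λ x y → :1 :* x :+ :0 :* y := x) refl
    bottom = solve 2 (λ x y → :0 :* x :+ :1 :* y := y) refl

  ·-identityʳ : ∀ M → M · I ≡ M
  ·-identityʳ (mat a b c d) = mat-cong (left a b) (right a b) (left c d) (right c d)
    where
    left  = solve 2 (λ x y → x :* :1 :+ y :* :0 := x) refl
    right = solve 2 (λ x y → x :* :0 :+ y :* :1 := y) refl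

  det-· : ∀ M N → det (M · N) ≡ det M * det N
  det-· (mat a b c d) (mat e f g h) = solve 8 (λ a b c d e f g h →
    (a :* e :+ b :* g) :* (c :* f :+ d :* h) :+ :- ((a :* f :+ b :* h) :* (c :* e :+ d :* g))
      := (a :* d :+ :- (b :* c)) :* (e :* h :+ :- (f :* g))) refl a b c d e f g h

  det-inv : ∀ M → det (inv M) ≡ det M
  det-inv (mat a b c d) =
    solve 4 (λ a b c d → d :* a :+ :- ((:- b) :* (:- c)) := a :* d :+ :- (b :* c)) refl a b c d

  det-neg : ∀ M → det (neg M) ≡ det M
  det-neg (mat a b c d) =
    solve 4 (λ a b c d → (:- a) :* (:- d) :+ :- ((:- b) :* (:- c)) := a :* d :+ :- (b :* c)) refl a b c d

  ·-inverseʳ : ∀ {M} → det M ≡ 1# → M · inv M ≡ I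
  ·-inverseʳ {mat a b c d} e = mat-cong
    (trans (solve 4 (λ a b c d → a :* d :+ b :* (:- c) := a :* d :+ :- (b :* c)) refl a b c d) e)
    (solve 2 (λ a b → a :* (:- b) :+ b :* a := :0) refl a b)
    (solve 2 (λ c d → c :* d :+ d :* (:- c) := :0) refl c d)
    (trans (solve 4 (λ a b c d → c :* (:- b) :+ d :* a := a :* d :+ :- (b :* c)) refl a b c d) e)

  inv-involutive : ∀ M → inv (inv M) ≡ M
  inv-involutive (mat a b c d) = mat-cong refl (-‿involutive b) (-‿involutive c) refl

  ·-inverseˡ : ∀ {M} → det M ≡ 1# → inv M · M ≡ I
  ·-inverseˡ {M} e = trans (cong (inv M ·_) (sym (inv-involutive M))) (·-inverseʳ (trans (det-inv M) e))

  inv-· : ∀ M N → inv (M · N) ≡ inv N · inv M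
  inv-· (mat a b c d) (mat e f g h) = mat-cong
    (solve 4 (λ c d f h → c :* f :+ d :* h := h :* d :+ (:- f) :* (:- c)) refl c d f h)
    (solve 4 (λ a b f h → :- (a :* f :+ b :* h) := h :* (:- b) :+ (:- f) :* a) refl a b f h)
    (solve 4 (λ c d e g → :- (c :* e :+ d :* g) := (:- g) :* d :+ e :* (:- c)) refl c d e g)
    (solve 4 (λ a b e g → a :* e :+ b :* g := (:- g) :* (:- b) :+ e :* a) refl a b e g)

  neg-involutive : ∀ M → neg (neg M) ≡ M
  neg-involutive (mat a b c d) = mat-cong (-‿involutive a) (-‿involutive b) (-‿involutive c) (-‿involutive d)

  neg-distribˡ-· : ∀ M N → neg M · N ≡ neg (M · N)
  neg-distribˡ-· (mat a b c d) (mat e f g h) =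
    mat-cong (entry a b e g) (entry a b f h) (entry c d e g) (entry c d f h)
    where entry = solve 4 (λ x y z w → (:- x) :* z :+ (:- y) :* w := :- (x :* z :+ y :* w)) refl

  neg-distribʳ-· : ∀ M N → M · neg N ≡ neg (M · N)
  neg-distribʳ-· (mat a b c d) (mat e f g h) =
    mat-cong (entry a b e g) (entry a b f h) (entry c d e g) (entry c d f h)
    where entry = solve 4 (λ x y z w → x :* (:- z) :+ y :* (:- w) := :- (x :* z :+ y :* w)) refl

  det-·-1 : ∀ {M N} → det M ≡ 1# → det N ≡ 1# → det (M · N) ≡ 1#
  det-·-1 {M} {N} eM eN = trans (det-· M N) (trans (cong₂ _*_ eM eN) (*-identityˡ 1#))

  det-I : det I ≡ 1#
  det-I = solve 1 (λ x → :1 :* :1 :+ :- (:0 :* :0) := :1) refl 0#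

  det-pow : ∀ {M} k → det M ≡ 1# → det (pow M k) ≡ 1#
  det-pow zero        e = det-I
  det-pow {M} (suc k) e = det-·-1 {M} e (det-pow k e)

  cancel-inverseˡ : ∀ {M} N → det M ≡ 1# → inv M · (M · N) ≡ N
  cancel-inverseˡ {M} N e = trans (sym (·-assoc (inv M) M N)) (trans (cong (_· N) (·-inverseˡ e)) (·-identityˡ N))

  cancel-inverseʳ : ∀ {M} N → det M ≡ 1# → (N · M) · inv M ≡ N
  cancel-inverseʳ {M} N e = trans (·-assoc N M (inv M)) (trans (cong (N ·_) (·-inverseʳ e)) (·-identityʳ N))

  pow-+ : ∀ M m n → pow M (m ℕ.+ n) ≡ pow M m · pow M n
  pow-+ M zero    n = sym (·-identityˡ _)
  pow-+ M (suc m) n = trans (cong (M ·_) (pow-+ M m n)) (sym (·-assoc M _ _))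

  pow-square : ∀ M k → pow (M · M) k ≡ pow M (k ℕ.+ k)
  pow-square M zero    = refl
  pow-square M (suc k) = begin
    (M · M) · pow (M · M) k       ≡⟨ cong ((M · M) ·_) (pow-square M k) ⟩
    (M · M) · pow M (k ℕ.+ k)     ≡⟨ ·-assoc M M _ ⟩
    M · pow M (suc (k ℕ.+ k))     ≡⟨ cong (λ j → M · pow M j) (ℕ.+-suc k k) ⟨
    M · pow M (k ℕ.+ suc k)       ∎

  pow-diag : ∀ u v k → pow (diag u v) k ≡ diag (u ^ k) (v ^ k)
  pow-diag u v zero    = refl
  pow-diag u v (suc k) = trans (cong (diag u v ·_) (pow-diag u v k)) (mat-cong
    (solve 2 (λ x y → x :* y :+ :0 :* :0 := x :* y) refl u (u ^ k))
    (solve 2 (λ x y → x :* :0 :+ :0 :* y := :0) refl u (v ^ k))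
    (solve 2 (λ x y → :0 :* y :+ x :* :0 := :0) refl v (u ^ k))
    (solve 2 (λ x y → :0 :* :0 :+ x :* y := x :* y) refl v (v ^ k)))

  -- For invertible x this is x M x⁻¹ = N. Without the inverse it passes to powers and compositions
  -- by associativity alone.
  Intertwines : Mat → Mat → Mat → Set
  Intertwines x M N = x · M ≡ N · x

  intertwines-pow : ∀ {x M N} k → Intertwines x M N → Intertwines x (pow M k) (pow N k)
  intertwines-pow {x} zero    e = trans (·-identityʳ x) (sym (·-identityˡ x))
  intertwines-pow {x} {M} {N} (suc k) e = begin
    x · (M · pow M k)   ≡⟨ ·-assoc x M _ ⟨
    (x · M) · pow M k   ≡⟨ cong (_· pow M k) e ⟩
    (N · x) · pow M k   ≡⟨ ·-assoc N x _ ⟩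
    N · (x · pow M k)   ≡⟨ cong (N ·_) (intertwines-pow k e) ⟩
    N · (pow N k · x)   ≡⟨ ·-assoc N _ x ⟨
    (N · pow N k) · x   ∎

  intertwines-inv : ∀ {x M N} → det x ≡ 1# → Intertwines x M N → Intertwines (inv x) N M
  intertwines-inv {x} {M} {N} ex e = begin
    inv x · N                    ≡⟨ cancel-inverseʳ (inv x · N) ex ⟨
    ((inv x · N) · x) · inv x    ≡⟨ cong (_· inv x) (·-assoc (inv x) N x) ⟩
    (inv x · (N · x)) · inv x    ≡⟨ cong (λ w → (inv x · w) · inv x) e ⟨
    (inv x · (x · M)) · inv x    ≡⟨ cong (_· inv x) (cancel-inverseˡ M ex) ⟩
    M · inv x                    ∎

  -- The left side of the conclusion is what `SameCoset` tests for the images of the point H z under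
  -- g and g′.
  intertwines⇒conjugate : ∀ {z g g′ N} → det z ≡ 1# → Intertwines z (g · inv g′) N → (z · g) · inv (z · g′) ≡ N
  intertwines⇒conjugate {z} {g} {g′} {N} ez e = begin
    (z · g) · inv (z · g′)        ≡⟨ cong ((z · g) ·_) (inv-· z g′) ⟩
    (z · g) · (inv g′ · inv z)    ≡⟨ ·-assoc (z · g) (inv g′) (inv z) ⟨
    ((z · g) · inv g′) · inv z    ≡⟨ cong (_· inv z) (·-assoc z g (inv g′)) ⟩
    (z · (g · inv g′)) · inv z    ≡⟨ cong (_· inv z) e ⟩
    (N · z) · inv z               ≡⟨ cancel-inverseʳ N ez ⟩
    N                             ∎

  intertwines-· : ∀ {x y M N P} → Intertwines y M N → Intertwines x N P → Intertwines (x · y) M P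
  intertwines-· {x} {y} {M} {N} {P} ey ex = begin
    (x · y) · M  ≡⟨ ·-assoc x y M ⟩
    x · (y · M)  ≡⟨ cong (x ·_) ey ⟩
    x · (N · y)  ≡⟨ ·-assoc x N y ⟨
    (x · N) · y  ≡⟨ cong (_· y) ex ⟩
    (P · x) · y  ≡⟨ ·-assoc P x y ⟩
    P · (x · y)  ∎

  -- Diagonalisation over the field when the eigenvalues are distinct.

  module _ (u v b c d : Carrier) (det≡ : u * v ≡ (u + v + - d) * d + - (b * c)) where

    -- By Cayley-Hamilton (M - v)(M - u) = 0, so the rows of M - v are left eigenvectors of M for u.
    -- This is the lower row, M having upper-left entry u + v - d.
    lower-left-eigenvector : c * (u + v + - d) + (d + - v) * c ≡ u * c × c * b + (d + - v) * d ≡ u * (d + - v)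
    lower-left-eigenvector =
      solve 4 (λ u v c d → c :* (u :+ v :+ :- d) :+ (d :+ :- v) :* c := u :* c) refl u v c d ,
      (begin
        c * b + (d + - v) * d
          ≡⟨ solve 5 (λ u v b c d → c :* b :+ (d :+ :- v) :* d
               := u :* d :+ :- ((u :+ v :+ :- d) :* d :+ :- (b :* c))) refl u v b c d ⟩
        u * d + - ((u + v + - d) * d + - (b * c))
          ≡⟨ cong (λ w → u * d + - w) det≡ ⟨
        u * d + - (u * v)
          ≡⟨ solve 3 (λ u v d → u :* d :+ :- (u :* v) := u :* (d :+ :- v)) refl u v d ⟩
        u * (d + - v) ∎)

  -- Left eigenvectors are the rows of the conjugating matrix. Dividing one of them by the
  -- determinant keeps it an eigenvector and brings the matrix into SL₂.
  eigenrows⇒diagonalisable : ∀ {a b c d u v p q s t} →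
    p * a + q * c ≡ u * p × p * b + q * d ≡ u * q →
    s * a + t * c ≡ v * s × s * b + t * d ≡ v * t →
    p * t + - (q * s) ≢ 0# →
    ∃ λ x → det x ≡ 1# × Intertwines x (mat a b c d) (diag u v)
  eigenrows⇒diagonalisable {a} {b} {c} {d} {u} {v} {p} {q} {s} {t} (e₁ , e₂) (e₃ , e₄) Δ≢0
    with k , Δk≡1 ← inverse _ Δ≢0 =
      mat (k * p) (k * q) s t ,
      trans (solve 5 (λ k p q s t → k :* p :* t :+ :- (k :* q :* s)
               := (p :* t :+ :- (q :* s)) :* k) refl k p q s t) Δk≡1 ,
      mat-cong (top p q a c p s e₁) (top p q b d q t e₂) (bottom e₃) (bottom e₄)
    where
    top : ∀ p q x y w z → p * x + q * y ≡ u * w → k * p * x + k * q * y ≡ u * (k * w) + 0# * z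
    top p q x y w z e = begin
      k * p * x + k * q * y
        ≡⟨ solve 5 (λ k p q x y → k :* p :* x :+ k :* q :* y
             := k :* (p :* x :+ q :* y)) refl k p q x y ⟩
      k * (p * x + q * y)     ≡⟨ cong (k *_) e ⟩
      k * (u * w)             ≡⟨ solve 4 (λ k u w z → k :* (u :* w) := u :* (k :* w) :+ :0 :* z) refl k u w z ⟩
      u * (k * w) + 0# * z    ∎
    bottom : ∀ {x w z} → x ≡ v * w → x ≡ 0# * z + v * w
    bottom {x} {w} {z} e = trans e (solve 3 (λ v w z → v :* w := :0 :* z :+ v :* w) refl v w z)

  diagonalisable : ∀ M {u v} → det M ≡ 1# → trace M ≡ u + v → u * v ≡ 1# → u ≢ v →
                   ∃ λ x → det x ≡ 1# × Intertwines x M (diag u v)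
  diagonalisable (mat a b c d) {u} {v} det≡1 tr uv≡1 u≢v =
    subst (λ a → ∃ λ x → det x ≡ 1# × Intertwines x (mat a b c d) (diag u v)) (sym a≡) cases
    where
    a≡ : a ≡ u + v + - d
    a≡ = trans (solve 2 (λ a d → a := a :+ d :+ :- d) refl a d) (cong (_+ - d) tr)
    det≡ : u * v ≡ (u + v + - d) * d + - (b * c)
    det≡ = trans uv≡1 (trans (sym det≡1) (cong (λ a → a * d + - (b * c)) a≡))
    det≡′ : v * u ≡ (v + u + - d) * d + - (b * c)
    det≡′ = trans (*-comm v u) (trans det≡
      (solve 4 (λ u v d w → (u :+ v :+ :- d) :* d :+ :- w
        := (v :+ u :+ :- d) :* d :+ :- w) refl u v d _))
    v-u≢0 : v + - u ≢ 0#
    v-u≢0 = x-y≢0 (u≢v ∘ sym)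
    d-eigenvalue : c ≡ 0# → d ≢ v → d ≡ u
    d-eigenvalue refl d≢v = x∙y⁻¹≈ε⇒x≈y d u (*-zero-divisor (d + - v) _ (begin
      (d + - v) * (d + - u)
        ≡⟨ solve 4 (λ u v b d → (d :+ :- v) :* (d :+ :- u)
             := u :* v :+ :- ((u :+ v :+ :- d) :* d :+ :- (b :* :0))) refl u v b d ⟩
      u * v + - ((u + v + - d) * d + - (b * 0#))  ≡⟨ cong (λ w → w + - ((u + v + - d) * d + - (b * 0#))) det≡ ⟩
      _                                           ≡⟨ -‿inverseʳ _ ⟩
      0#                                          ∎) (x-y≢0 d≢v))
    cases : ∃ λ x → det x ≡ 1# × Intertwines x (mat (u + v + - d) b c d) (diag u v)
    cases with c ≟ 0#
    -- The lower rows of M - v and M - u are independent: their determinant is c (v - u).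
    ... | no c≢0 = eigenrows⇒diagonalisable {u + v + - d} {b} {c} {d} {u} {v} {p = c} {d + - v} {c} {d + - u}
            (lower-left-eigenvector u v b c d det≡)
            (subst (λ w → c * (w + - d) + (d + - u) * c ≡ v * c × c * b + (d + - u) * d ≡ v * (d + - u))
              (solve 2 (λ u v → v :+ u := u :+ v) refl u v) (lower-left-eigenvector v u b c d det≡′))
            (subst (_≢ 0#)
              (solve 4 (λ u v c d → c :* (v :+ :- u)
                := c :* (d :+ :- u) :+ :- ((d :+ :- v) :* c)) refl u v c d)
              (*-≢0 c≢0 v-u≢0))
    -- M is now upper triangular, so d is v or u. Then (0,1) is a left eigenvector for d, and the
    -- upper row of M - d is one for the other eigenvalue.
    ... | yes refl with d ≟ v
    ... | yes refl = eigenrows⇒diagonalisable {u + v + - d} {b} {c} {d} {u} {v} {p = u + - v} {b} {0#} {1#}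
            ( solve 3 (λ u v b → (u :+ :- v) :* (u :+ v :+ :- v) :+ b :* :0 := u :* (u :+ :- v)) refl u v b
            , solve 3 (λ u v b → (u :+ :- v) :* b :+ b :* v := u :* b) refl u v b)
            ( solve 2 (λ u v → :0 :* (u :+ v :+ :- v) :+ :1 :* :0 := v :* :0) refl u v
            , solve 2 (λ b v → :0 :* b :+ :1 :* v := v :* :1) refl b v)
            (subst (_≢ 0#) (solve 3 (λ u v b → u :+ :- v := (u :+ :- v) :* :1 :+ :- (b :* :0)) refl u v b)
              (x-y≢0 u≢v))
    ... | no d≢v =
          subst (λ w → ∃ λ x → det x ≡ 1# × Intertwines x (mat (u + v + - w) b 0# w) (diag u v))
            (sym (d-eigenvalue refl d≢v))
            (eigenrows⇒diagonalisable {u + v + - u} {b} {0#} {u} {u} {v} {0#} {1#} {v + - u} {b}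
            ( solve 2 (λ u v → :0 :* (u :+ v :+ :- u) :+ :1 :* :0 := u :* :0) refl u v
            , solve 2 (λ b u → :0 :* b :+ :1 :* u := u :* :1) refl b u)
            ( solve 3 (λ u v b → (v :+ :- u) :* (u :+ v :+ :- u) :+ b :* :0 := v :* (v :+ :- u)) refl u v b
            , solve 3 (λ u v b → (v :+ :- u) :* b :+ b :* u := v :* b) refl u v b)
            (subst (_≢ 0#) (solve 3 (λ u v b → u :+ :- v := :0 :* b :+ :- (:1 :* (v :+ :- u))) refl u v b)
              (x-y≢0 u≢v)))

  -- Equality up to sign, and eigenvalues of elements of prime order.

  ≈-sym : ∀ {M N} → M ≈ N → N ≈ M
  ≈-sym (inj₁ refl) = inj₁ refl
  ≈-sym (inj₂ refl) = inj₂ (sym (neg-involutive _))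

  ≈-trans : ∀ {M N P} → M ≈ N → N ≈ P → M ≈ P
  ≈-trans (inj₁ refl) e           = e
  ≈-trans (inj₂ refl) (inj₁ refl) = inj₂ refl
  ≈-trans (inj₂ refl) (inj₂ refl) = inj₁ (neg-involutive _)

  ·-congˡ-≈ : ∀ P {M N} → M ≈ N → P · M ≈ P · N
  ·-congˡ-≈ P (inj₁ refl) = inj₁ refl
  ·-congˡ-≈ P (inj₂ refl) = inj₂ (neg-distribʳ-· P _)

  ·-congʳ-≈ : ∀ P {M N} → M ≈ N → M · P ≈ N · P
  ·-congʳ-≈ P (inj₁ refl) = inj₁ refl
  ·-congʳ-≈ P (inj₂ refl) = inj₂ (neg-distribˡ-· _ P)

  ·-cancelˡ-≈ : ∀ {P M N} → det P ≡ 1# → P · M ≈ P · N → M ≈ N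
  ·-cancelˡ-≈ {P} {M} {N} e eq =
    ≈-trans (inj₁ (sym (cancel-inverseˡ M e))) (≈-trans (·-congˡ-≈ (inv P) eq) (inj₁ (cancel-inverseˡ N e)))

  det-≈ : ∀ {M N} → M ≈ N → det M ≡ det N
  det-≈ (inj₁ refl) = refl
  det-≈ (inj₂ refl) = det-neg _

  -- Cayley-Hamilton, M² = (a + d) M - I, applied to a column (x,y) and read in the first
  -- coordinate; `recurrence₂` reads the second.
  recurrence₁ : ∀ {a b c d} → det (mat a b c d) ≡ 1# → ∀ x y →
    a * (a * x + b * y) + b * (c * x + d * y) ≡ (a + d) * (a * x + b * y) + - x
  recurrence₁ {a} {b} {c} {d} e x y = begin
    a * (a * x + b * y) + b * (c * x + d * y)
      ≡⟨ solve 6 (λ a b c d x y → a :* (a :* x :+ b :* y) :+ b :* (c :* x :+ d :* y)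
           := (a :+ d) :* (a :* x :+ b :* y) :+ :- ((a :* d :+ :- (b :* c)) :* x)) refl a b c d x y ⟩
    (a + d) * (a * x + b * y) + - ((a * d + - (b * c)) * x)
      ≡⟨ cong (λ w → (a + d) * (a * x + b * y) + - w) (trans (cong (_* x) e) (*-identityˡ x)) ⟩
    (a + d) * (a * x + b * y) + - x ∎

  recurrence₂ : ∀ {a b c d} → det (mat a b c d) ≡ 1# → ∀ x y →
    c * (a * x + b * y) + d * (c * x + d * y) ≡ (a + d) * (c * x + d * y) + - y
  recurrence₂ {a} {b} {c} {d} e x y = begin
    c * (a * x + b * y) + d * (c * x + d * y)
      ≡⟨ solve 6 (λ a b c d x y → c :* (a :* x :+ b :* y) :+ d :* (c :* x :+ d :* y)
           := (a :+ d) :* (c :* x :+ d :* y) :+ :- ((a :* d :+ :- (b :* c)) :* y)) refl a b c d x y ⟩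
    (a + d) * (c * x + d * y) + - ((a * d + - (b * c)) * y)
      ≡⟨ cong (λ w → (a + d) * (c * x + d * y) + - w) (trans (cong (_* y) e) (*-identityˡ y)) ⟩
    (a + d) * (c * x + d * y) + - y ∎

  ∈-SL⁺ : ∀ {M} → det M ≡ 1# → M ∈ SL
  ∈-SL⁺ {M@(mat a b c d)} = ∈-filter⁺ (λ M → det M ≟ 1#)
    (∈-concatMap⁺ _ (lose (elements-complete a)
      (∈-concatMap⁺ _ (lose (elements-complete b)
        (∈-concatMap⁺ _ (lose (elements-complete c)
          (∈-map⁺ (mat a b c) (elements-complete d))))))))

  ∈-SL⁻ : ∀ {M} → M ∈ SL → det M ≡ 1#
  ∈-SL⁻ M∈ = proj₂ (∈-filter⁻ (λ M → det M ≟ 1#) {xs = allMats} M∈)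

  -- Each entry of `pow M k` is a sequence in k of period p obeying the Cayley-Hamilton recurrence.
  -- As M ≠ I, some entry changes from k = 0 to k = 1, and `characteristic-root` applied to it finds
  -- a root of X² - (trace M) X + 1 in the field.
  eigenvalue : ∀ {p ζ M} → Prime p → ζ ^ p ≡ 1# → ζ ≢ 1# →
    det M ≡ 1# → pow M p ≡ I → M ≢ I →
    ∃ λ x → x ^ p ≡ 1# × x ≢ 1# × trace M * x ≡ 1# + x * x
  eigenvalue {p} {ζ} {M@(mat a b c d)} pp ζ^p ζ≢1 e M^p≡I M≢I = cases
    where
    from-entry : (entry : Mat → Carrier) → (∀ N → entry (M · (M · N)) ≡ trace M * entry (M · N) + - entry N) →
      entry M ≢ entry I → ∃ λ x → x ^ p ≡ 1# × x ≢ 1# × trace M * x ≡ 1# + x * x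
    from-entry entry rec ≢ = characteristic-root pp ζ^p ζ≢1 (trace M) (entry ∘ pow M) (λ k → rec (pow M k))
      (cong entry M^p≡I) (cong (λ N → entry (M · N)) M^p≡I)
      (≢ ∘ trans (cong entry (sym (·-identityʳ M))))
    cases : ∃ λ x → x ^ p ≡ 1# × x ≢ 1# × trace M * x ≡ 1# + x * x
    cases with a ≟ 1# | b ≟ 0# | c ≟ 0# | d ≟ 1#
    ... | yes a≡1 | yes b≡0 | yes c≡0 | yes d≡1 = ⊥-elim (M≢I (mat-cong a≡1 b≡0 c≡0 d≡1))
    ... | no a≢1 | _ | _ | _ = from-entry Mat.a (λ N → recurrence₁ e (Mat.a N) (Mat.c N)) a≢1
    ... | yes _ | no b≢0 | _ | _ = from-entry Mat.b (λ N → recurrence₁ e (Mat.b N) (Mat.d N)) b≢0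
    ... | yes _ | yes _ | no c≢0 | _ = from-entry Mat.c (λ N → recurrence₂ e (Mat.a N) (Mat.c N)) c≢0
    ... | yes _ | yes _ | yes _ | no d≢1 = from-entry Mat.d (λ N → recurrence₂ e (Mat.b N) (Mat.d N)) d≢1

  ≈-decSetoid : DecSetoid 0ℓ 0ℓ
  ≈-decSetoid = record
    { Carrier = Mat
    ; _≈_ = _≈_
    ; isDecEquivalence = record
      { isEquivalence = record { refl = inj₁ refl ; sym = ≈-sym ; trans = ≈-trans }
      ; _≟_ = _≈?_
      }
    }

  -- Counting cosets of H.

  module CyclicSubgroup (h : Mat) (n : ℕ) (det-h : det h ≡ 1#) (h^r≈I : pow h (suc n) ≈ I) where
    r : ℕ
    r = suc n

    open Cosets h r

    pow-multiple : ∀ k → pow h (k ℕ.* r) ≈ I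
    pow-multiple zero    = inj₁ refl
    pow-multiple (suc k) = ≈-trans (inj₁ (pow-+ h r (k ℕ.* r)))
      (≈-trans (·-congʳ-≈ (pow h (k ℕ.* r)) h^r≈I) (≈-trans (inj₁ (·-identityˡ _)) (pow-multiple k)))

    pow-% : ∀ k → pow h k ≈ pow h (k % r)
    pow-% k = ≈-trans (inj₁ (trans (cong (pow h) (m≡m%n+[m/n]*n k r)) (pow-+ h (k % r) _)))
      (≈-trans (·-congˡ-≈ (pow h (k % r)) (pow-multiple (k / r))) (inj₁ (·-identityʳ _)))

    InH-pow : ∀ k → InH (pow h k)
    InH-pow k = fromℕ< (m%n<n k r) , subst (λ j → pow h k ≈ pow h j) (sym (Fin.toℕ-fromℕ< (m%n<n k r))) (pow-% k)

    -- Membership of y in the coset H x, as a predicate in y for fixed x, so that a representative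
    -- of the coset of x can be tracked through `deduplicate`.
    Translate : Mat → Mat → Set
    Translate x y = ∃ λ (k : Fin r) → y ≈ pow h (toℕ k) · x

    Translate-refl : ∀ x → Translate x x
    Translate-refl x = Fin.zero , inj₁ (sym (·-identityˡ x))

    Translate-det : ∀ {x y} → det x ≡ 1# → Translate x y → det y ≡ 1#
    Translate-det {x} ex (k , y≈) = trans (det-≈ y≈) (det-·-1 {pow h (toℕ k)} (det-pow (toℕ k) det-h) ex)

    Translate-SameCoset : ∀ {x y z} → det x ≡ 1# → SameCoset z y → Translate x y → Translate x z
    Translate-SameCoset {x} {y} {z} ex (j , zy⁻¹≈hʲ) t@(k , y≈hᵏx) =
      proj₁ reduced , ≈-trans {z} {pow h (toℕ j ℕ.+ toℕ k) · x} z≈ (·-congʳ-≈ x (proj₂ reduced))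
      where
      reduced = InH-pow (toℕ j ℕ.+ toℕ k)
      z≡ : z ≡ (z · inv y) · y
      z≡ = sym (trans (·-assoc z (inv y) y)
        (trans (cong (z ·_) (·-inverseˡ (Translate-det ex t))) (·-identityʳ z)))
      hʲhᵏx≡ : pow h (toℕ j) · (pow h (toℕ k) · x) ≡ pow h (toℕ j ℕ.+ toℕ k) · x
      hʲhᵏx≡ = trans (sym (·-assoc (pow h (toℕ j)) (pow h (toℕ k)) x))
        (cong (_· x) (sym (pow-+ h (toℕ j) (toℕ k))))
      z≈ : z ≈ pow h (toℕ j ℕ.+ toℕ k) · x
      z≈ = ≈-trans {z} {(z · inv y) · y} (inj₁ z≡) (≈-trans (·-congʳ-≈ y zy⁻¹≈hʲ)
        (≈-trans (·-congˡ-≈ (pow h (toℕ j)) y≈hᵏx) (inj₁ hʲhᵏx≡)))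

    Ω : List Mat
    Ω = deduplicate SameCoset? SL

    translate-in-Ω : ∀ {x} → x ∈ SL → Any (Translate x) Ω
    translate-in-Ω {x} x∈ = Any.deduplicate⁺ SameCoset? (Translate-SameCoset (∈-SL⁻ x∈))
      (lose x∈ (Translate-refl x))

    -- An element g is encoded by the representative y of its coset and an exponent k with y ≈ hᵏ g.
    -- Cancelling hᵏ shows that the code determines g.
    |G|≤|Ω|*r : |G| ℕ.≤ |Ω| ℕ.* r
    |G|≤|Ω|*r = Fin.injective⇒≤ {f = code} code-injective
      where
      G : List Mat
      G = deduplicate _≈?_ SL
      G⊆SL : ∀ i → lookup G i ∈ SL
      G⊆SL i = ∈-deduplicate⁻ _≈?_ SL (∈-lookup i)
      rep : ∀ i → Any (Translate (lookup G i)) Ω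
      rep i = translate-in-Ω (G⊆SL i)
      exponent : ∀ i → Fin r
      exponent i = proj₁ (Any.lookup-index (rep i))
      code : Fin |G| → Fin (|Ω| ℕ.* r)
      code i = combine (index (rep i)) (exponent i)
      code-injective : ∀ {i j} → code i ≡ code j → i ≡ j
      code-injective {i} {j} eq = AllPairs-lookup-injective {_∼_ = _≈_} ≈-sym
        (UniqueDecSetoid.deduplicate-! ≈-decSetoid SL) i j
        (·-cancelˡ-≈ (det-pow (toℕ (exponent i)) det-h)
          (≈-trans (≈-sym (proj₂ (Any.lookup-index (rep i))))
            (subst (λ (y , k) → lookup Ω y ≈ pow h (toℕ k) · lookup G j)
              (sym (cong₂ _,_ (proj₁ eqs) (proj₂ eqs))) (proj₂ (Any.lookup-index (rep j))))))
        where
        eqs = Fin.combine-injective (index (rep i)) (exponent i) (index (rep j)) (exponent j) eq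

  -- Elements of odd order, and traces of the quotients g g′⁻¹.

  odd-order-square : ∀ {x} n → x ^ suc (n ℕ.+ n) ≡ 1# → x * x ≡ 1# → x ≡ 1#
  odd-order-square {x} n e x²≡1 = begin
    x                  ≡⟨ *-identityʳ x ⟨
    x * 1#             ≡⟨ cong (x *_) (1^ n) ⟨
    x * 1# ^ n         ≡⟨ cong (λ y → x * y ^ n) x²≡1 ⟨
    x * (x * x) ^ n    ≡⟨ cong (x *_) (^-distrib-* x x n) ⟩
    x * (x ^ n * x ^ n) ≡⟨ cong (x *_) (^-homo-* x n n) ⟨
    x ^ suc (n ℕ.+ n)  ≡⟨ e ⟩
    1#                 ∎

  -- (u - 1)² = u² - (u + v) u + u v vanishes.
  trace-2 : ∀ {u v} → u * v ≡ 1# → u + v ≡ 1# + 1# → u ≡ 1#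
  trace-2 {u} {v} uv≡1 tr = decidable-stable (u ≟ 1#) λ u≢1 →
    *-≢0 (x-y≢0 u≢1) (x-y≢0 u≢1) (begin
      (u + - 1#) * (u + - 1#)
        ≡⟨ solve 1 (λ u → (u :+ :- :1) :* (u :+ :- :1)
             := u :* u :+ :- ((:1 :+ :1) :* u) :+ :1) refl u ⟩
      u * u + - ((1# + 1#) * u) + 1#   ≡⟨ cong₂ (λ t y → u * u + - (t * u) + y) tr uv≡1 ⟨
      u * u + - ((u + v) * u) + u * v
        ≡⟨ solve 2 (λ u v → u :* u :+ :- ((u :+ v) :* u) :+ u :* v
             := :0) refl u v ⟩
      0#                               ∎)

  -- Distinctness in PSL must rule out both signs. M = I has trace 2 and forces u = 1. M = -I forces
  -- -u = 1, hence u² = 1, and the odd order of u again gives u = 1.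
  trace-I : ∀ {u v} n → u ^ suc (n ℕ.+ n) ≡ 1# → u * v ≡ 1# → ∀ {M} → M ≈ I → trace M ≡ u + v → u ≡ 1#
  trace-I n _ uv≡1 (inj₁ refl) tr = trace-2 uv≡1 (sym tr)
  trace-I {u} {v} n u^r uv≡1 (inj₂ refl) tr = odd-order-square n u^r (begin
    u * u          ≡⟨ solve 1 (λ u → u :* u := (:- u) :* (:- u)) refl u ⟩
    (- u) * (- u)  ≡⟨ cong₂ _*_ -u≡1 -u≡1 ⟩
    1# * 1#        ≡⟨ *-identityˡ 1# ⟩
    1#             ∎)
    where
    -u≡1 : - u ≡ 1#
    -u≡1 = trace-2 {v = - v} (trans (solve 2 (λ u v → (:- u) :* (:- v) := u :* v) refl u v) uv≡1)
      (trans (solve 2 (λ u v → (:- u) :+ (:- v) := :- (u :+ v)) refl u v)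
        (trans (cong -_ (sym tr)) (trans (solve 1 (λ x → :- ((:- x) :+ (:- x)) := x :+ x) refl 1#) refl)))

  -- The off-diagonal entries are chosen to make (1,1) a right eigenvector: `upper a b` has
  -- eigenvectors (1,0) and (1,1) for a and b, `lower a b` has (1,1) and (0,1) for a and b.
  upper lower : Carrier → Carrier → Mat
  upper a b = mat a (b + - a) 0# b
  lower a b = mat a 0# (a + - b) b

  det-diag : ∀ a b → det (diag b a) ≡ a * b
  det-diag = solve 2 (λ a b → b :* a :+ :- (:0 :* :0) := a :* b) refl

  det-upper : ∀ a b → det (upper a b) ≡ a * b
  det-upper = solve 2 (λ a b → a :* b :+ :- ((b :+ :- a) :* :0) := a :* b) refl

  det-lower : ∀ a b → det (lower a b) ≡ a * b
  det-lower = solve 2 (λ a b → a :* b :+ :- (:0 :* (a :+ :- b)) := a :* b) refl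

  -- The factors `1#` stand for l⁰ and m⁰, so that `I` can be treated as a member of index 0 in
  -- `compatible-sum`.
  trace-I-D : ∀ a b → trace (I · inv (diag b a)) ≡ a * 1# + b * 1#
  trace-I-D =
    solve 2 (λ a b → :1 :* a :+ :0 :* (:- :0) :+ (:0 :* (:- :0) :+ :1 :* b)
      := a :* :1 :+ b :* :1) refl

  trace-I-upper : ∀ a b → trace (I · inv (upper a b)) ≡ a * 1# + b * 1#
  trace-I-upper =
    solve 2 (λ a b → :1 :* b :+ :0 :* (:- :0) :+ (:0 :* (:- (b :+ :- a)) :+ :1 :* a)
      := a :* :1 :+ b :* :1) refl

  trace-I-lower : ∀ a b → trace (I · inv (lower a b)) ≡ a * 1# + b * 1#
  trace-I-lower =
    solve 2 (λ a b → :1 :* b :+ :0 :* (:- (a :+ :- b)) :+ (:0 :* (:- :0) :+ :1 :* a)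
      := a :* :1 :+ b :* :1) refl

  trace-D-D : ∀ a b c d → trace (diag b a · inv (diag d c)) ≡ a * d + b * c
  trace-D-D =
    solve 4 (λ a b c d → b :* c :+ :0 :* (:- :0) :+ (:0 :* (:- :0) :+ a :* d)
      := a :* d :+ b :* c) refl

  trace-upper-upper : ∀ a b c d → trace (upper a b · inv (upper c d)) ≡ a * d + b * c
  trace-upper-upper =
    solve 4 (λ a b c d → a :* d :+ (b :+ :- a) :* (:- :0) :+ (:0 :* (:- (d :+ :- c)) :+ b :* c)
      := a :* d :+ b :* c) refl

  trace-lower-lower : ∀ a b c d → trace (lower a b · inv (lower c d)) ≡ a * d + b * c
  trace-lower-lower =
    solve 4 (λ a b c d → a :* d :+ :0 :* (:- (c :+ :- d)) :+ ((a :+ :- b) :* (:- :0) :+ b :* c)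
      := a :* d :+ b :* c) refl

  trace-D-upper : ∀ a b c d → trace (diag b a · inv (upper c d)) ≡ a * c + b * d
  trace-D-upper =
    solve 4 (λ a b c d → b :* d :+ :0 :* (:- :0) :+ (:0 :* (:- (d :+ :- c)) :+ a :* c)
      := a :* c :+ b :* d) refl

  trace-D-lower : ∀ a b c d → trace (diag b a · inv (lower c d)) ≡ a * c + b * d
  trace-D-lower =
    solve 4 (λ a b c d → b :* d :+ :0 :* (:- (c :+ :- d)) :+ (:0 :* (:- :0) :+ a :* c)
      := a :* c :+ b :* d) refl

  trace-upper-lower : ∀ a b c d → trace (upper a b · inv (lower c d)) ≡ a * c + b * d
  trace-upper-lower =
    solve 4 (λ a b c d → a :* d :+ (b :+ :- a) :* (:- (c :+ :- d)) :+ (:0 :* (:- :0) :+ b :* c)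
      := a :* c :+ b :* d) refl

  -- The intersecting family.

  module _ (l : Carrier) (n : ℕ) (pr : Prime (suc (n ℕ.+ n)))
           (l^r≡1 : l ^ suc (n ℕ.+ n) ≡ 1#) (l≢1 : l ≢ 1#) where

    private
      r : ℕ
      r = suc (n ℕ.+ n)

      -- This is l⁻¹, because l^(2n+1) = 1. As a power of l it keeps all exponents natural.
      m : Carrier
      m = l ^ (n ℕ.+ n)

    l^i*m^i≡1 : ∀ i → l ^ i * m ^ i ≡ 1#
    l^i*m^i≡1 i = trans (sym (^-distrib-* l m i)) (trans (^-congˡ i l^r≡1) (1^ i))

    -- By trace, g g′⁻¹ is conjugate to diag(lᵉ , l⁻ᵉ) ≠ I.
    Compatible : Mat → Mat → Set
    Compatible g g′ = ∃₂ λ e v → trace (g · inv g′) ≡ l ^ e + v × l ^ e * v ≡ 1# × l ^ e ≢ 1#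

    compatible-sum : ∀ {g g′} i j → 0 ℕ.< i ℕ.+ j → i ℕ.+ j ℕ.< r →
      trace (g · inv g′) ≡ l ^ i * l ^ j + m ^ i * m ^ j → Compatible g g′
    compatible-sum i j 0<i+j i+j<r tr = i ℕ.+ j , m ^ i * m ^ j ,
      trans tr (cong (_+ m ^ i * m ^ j) (sym (^-homo-* l i j))) ,
      (begin
        l ^ (i ℕ.+ j) * (m ^ i * m ^ j)      ≡⟨ cong (_* (m ^ i * m ^ j)) (^-homo-* l i j) ⟩
        l ^ i * l ^ j * (m ^ i * m ^ j)
          ≡⟨ solve 4 (λ a b c d → a :* b :* (c :* d)
               := a :* c :* (b :* d)) refl (l ^ i) (l ^ j) (m ^ i) (m ^ j) ⟩
        l ^ i * m ^ i * (l ^ j * m ^ j)      ≡⟨ cong₂ _*_ (l^i*m^i≡1 i) (l^i*m^i≡1 j) ⟩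
        1# * 1#                              ≡⟨ *-identityˡ 1# ⟩
        1#                                   ∎) ,
      ^-injective-< pr l^r≡1 l≢1 0<i+j i+j<r ∘ sym

    compatible-difference : ∀ {g g′} i j → i ℕ.< j → j ℕ.< r →
      trace (g · inv g′) ≡ l ^ i * m ^ j + m ^ i * l ^ j → Compatible g g′
    -- The exponent i + 2n j stands for i - j, since l^(2n) = l⁻¹.
    compatible-difference i j i<j j<r tr = i ℕ.+ (n ℕ.+ n) ℕ.* j , m ^ i * l ^ j ,
      trans tr (cong (_+ m ^ i * l ^ j) (sym power)) ,
      (begin
        l ^ (i ℕ.+ (n ℕ.+ n) ℕ.* j) * (m ^ i * l ^ j) ≡⟨ cong (_* (m ^ i * l ^ j)) power ⟩
        l ^ i * m ^ j * (m ^ i * l ^ j)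
          ≡⟨ solve 4 (λ a b c d → a :* b :* (c :* d)
               := a :* c :* (d :* b)) refl (l ^ i) (m ^ j) (m ^ i) (l ^ j) ⟩
        l ^ i * m ^ i * (l ^ j * m ^ j)      ≡⟨ cong₂ _*_ (l^i*m^i≡1 i) (l^i*m^i≡1 j) ⟩
        1# * 1#                              ≡⟨ *-identityˡ 1# ⟩
        1#                                   ∎) ,
      λ lᵉ≡1 → ^-injective-< pr l^r≡1 l≢1 i<j j<r (begin
        l ^ i                    ≡⟨ *-identityʳ _ ⟨
        l ^ i * 1#               ≡⟨ cong (l ^ i *_) (l^i*m^i≡1 j) ⟨
        l ^ i * (l ^ j * m ^ j)
          ≡⟨ solve 3 (λ a b c → a :* (b :* c)
               := a :* c :* b) refl (l ^ i) (l ^ j) (m ^ j) ⟩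
        l ^ i * m ^ j * l ^ j    ≡⟨ cong (_* l ^ j) (trans (sym power) lᵉ≡1) ⟩
        1# * l ^ j               ≡⟨ *-identityˡ _ ⟩
        l ^ j                    ∎)
      where
      power : l ^ (i ℕ.+ (n ℕ.+ n) ℕ.* j) ≡ l ^ i * m ^ j
      power = trans (^-homo-* l i _) (cong (l ^ i *_) (sym (^-assocʳ l (n ℕ.+ n) j)))

    compatible⇒≉ : ∀ {g g′} → det g′ ≡ 1# → Compatible g g′ → ¬ g ≈ g′
    compatible⇒≉ {g} {g′} eg′ (e , v , tr , lᵉv≡1 , lᵉ≢1) g≈g′ =
      lᵉ≢1 (trace-I n (trans (^-assocʳ l e r) (^-∣ l^r≡1 (divides e refl))) lᵉv≡1
        (≈-trans (·-congʳ-≈ (inv g′) g≈g′) (inj₁ (·-inverseʳ eg′))) tr)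

    -- In `D` the power of m comes first. In the other order the quotient of `D i` by `U j` or `L j`
    -- would have trace l^(i-j) + l^(j-i), which is 2 for i = j.
    D U L : ℕ → Mat
    D i = diag (m ^ i) (l ^ i)
    U i = upper (l ^ i) (m ^ i)
    L i = lower (l ^ i) (m ^ i)

    family : List Mat
    family = I ∷ applyUpTo (D ∘ suc) n ++ applyUpTo (U ∘ suc) n ++ applyUpTo (L ∘ suc) n

    length-family : length family ≡ suc (n ℕ.+ (n ℕ.+ n))
    length-family = cong suc (trans (length-++ (applyUpTo (D ∘ suc) n)) (cong₂ ℕ._+_ (length-applyUpTo _ n)
      (trans (length-++ (applyUpTo (U ∘ suc) n)) (cong₂ ℕ._+_ (length-applyUpTo _ n) (length-applyUpTo _ n)))))

    All-family : ∀ {P : Mat → Set} → (∀ {i} → i ℕ.< n → P (D (suc i))) → (∀ {i} → i ℕ.< n → P (U (suc i))) →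
      (∀ {i} → i ℕ.< n → P (L (suc i))) →
      All P (applyUpTo (D ∘ suc) n ++ applyUpTo (U ∘ suc) n ++ applyUpTo (L ∘ suc) n)
    All-family pD pU pL = All.++⁺ (All.applyUpTo⁺₁ _ n pD) (All.++⁺ (All.applyUpTo⁺₁ _ n pU) (All.applyUpTo⁺₁ _ n pL))

    det-family : All (λ g → det g ≡ 1#) family
    det-family = det-I ∷ All-family
      (λ {i} _ → trans (det-diag (l ^ suc i) (m ^ suc i)) (l^i*m^i≡1 (suc i)))
      (λ {i} _ → trans (det-upper (l ^ suc i) (m ^ suc i)) (l^i*m^i≡1 (suc i)))
      (λ {i} _ → trans (det-lower (l ^ suc i) (m ^ suc i)) (l^i*m^i≡1 (suc i)))

    family-compatible : AllPairs Compatible family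
    family-compatible =
      All-family
        (λ {i} i<n → with-I i i<n (trace-I-D (l ^ suc i) (m ^ suc i)))
        (λ {i} i<n → with-I i i<n (trace-I-upper (l ^ suc i) (m ^ suc i)))
        (λ {i} i<n → with-I i i<n (trace-I-lower (l ^ suc i) (m ^ suc i)))
      ∷ AllPairs.++⁺
        (AllPairs.applyUpTo⁺₁ _ n λ {i} {j} i<j j<n → compatible-difference (suc i) (suc j) (s≤s i<j) (<r j<n)
          (trace-D-D (l ^ suc i) (m ^ suc i) (l ^ suc j) (m ^ suc j)))
        (AllPairs.++⁺
          (AllPairs.applyUpTo⁺₁ _ n λ {i} {j} i<j j<n → compatible-difference (suc i) (suc j) (s≤s i<j) (<r j<n)
            (trace-upper-upper (l ^ suc i) (m ^ suc i) (l ^ suc j) (m ^ suc j)))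
          (AllPairs.applyUpTo⁺₁ _ n λ {i} {j} i<j j<n → compatible-difference (suc i) (suc j) (s≤s i<j) (<r j<n)
            (trace-lower-lower (l ^ suc i) (m ^ suc i) (l ^ suc j) (m ^ suc j)))
          (All.applyUpTo⁺₁ _ n λ {i} i<n → All.applyUpTo⁺₁ _ n λ {j} j<n → sum i j i<n j<n
            (trace-upper-lower (l ^ suc i) (m ^ suc i) (l ^ suc j) (m ^ suc j))))
        (All.applyUpTo⁺₁ _ n λ {i} i<n → All.++⁺
          (All.applyUpTo⁺₁ _ n λ {j} j<n → sum i j i<n j<n
            (trace-D-upper (l ^ suc i) (m ^ suc i) (l ^ suc j) (m ^ suc j)))
          (All.applyUpTo⁺₁ _ n λ {j} j<n → sum i j i<n j<n
            (trace-D-lower (l ^ suc i) (m ^ suc i) (l ^ suc j) (m ^ suc j))))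
      where
      <r : ∀ {j} → j ℕ.< n → suc j ℕ.< r
      <r j<n = s≤s (ℕ.≤-trans j<n (ℕ.m≤m+n n n))
      sum : ∀ i j → i ℕ.< n → j ℕ.< n → ∀ {g g′} →
        trace (g · inv g′) ≡ l ^ suc i * l ^ suc j + m ^ suc i * m ^ suc j → Compatible g g′
      sum i j i<n j<n = compatible-sum (suc i) (suc j) (s≤s z≤n) (s≤s (ℕ.+-mono-≤ i<n j<n))
      with-I : ∀ i → i ℕ.< n → ∀ {g g′} →
        trace (g · inv g′) ≡ l ^ suc i * l ^ 0 + m ^ suc i * m ^ 0 → Compatible g g′
      with-I i i<n = compatible-sum (suc i) 0 (s≤s z≤n) (subst (ℕ._< r) (sym (ℕ.+-identityʳ (suc i))) (<r i<n))

    module _ {h y : Mat} (det-h : det h ≡ 1#) (h^r≈I : pow h r ≈ I)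
             (det-y : det y ≡ 1#) (y-diagonalises : Intertwines y (h · h) (diag l m)) where
      open Cosets h r
      open CyclicSubgroup h (n ℕ.+ n) det-h h^r≈I using (InH-pow)

      -- The common point is H z with z = y⁻¹ x: x carries g g′⁻¹ to diag(l,m)ᵉ, and y⁻¹ carries
      -- that to (h²)ᵉ, so z g (z g′)⁻¹ = h^(2e) lies in H.
      conjugate⇒intersect : ∀ {x g g′} e → det x ≡ 1# → Intertwines x (g · inv g′) (pow (diag l m) e) → Intersect g g′
      conjugate⇒intersect {x} {g} {g′} e ex x-diagonalises =
        inv y · x , ∈-SL⁺ {inv y · x} ez , subst InH (sym ratio) (InH-pow (e ℕ.+ e))
        where
        ez : det (inv y · x) ≡ 1#
        ez = det-·-1 {inv y} {x} (trans (det-inv y) det-y) ex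
        y⁻¹-intertwines : Intertwines (inv y) (pow (diag l m) e) (pow (h · h) e)
        y⁻¹-intertwines = intertwines-inv {y} {pow (h · h) e} {pow (diag l m) e} det-y
          (intertwines-pow {y} {h · h} {diag l m} e y-diagonalises)
        ratio : ((inv y · x) · g) · inv ((inv y · x) · g′) ≡ pow h (e ℕ.+ e)
        ratio = trans (intertwines⇒conjugate {inv y · x} {g} {g′} {pow (h · h) e} ez
          (intertwines-· {inv y} {x} {g · inv g′} {pow (diag l m) e} {pow (h · h) e} x-diagonalises y⁻¹-intertwines))
          (pow-square h e)

      compatible⇒intersect : ∀ {g g′} → det g ≡ 1# → det g′ ≡ 1# → Compatible g g′ → Intersect g g′
      compatible⇒intersect {g} {g′} eg eg′ (e , v , tr , lᵉv≡1 , lᵉ≢1) = from-diagonalisation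
        (diagonalisable (g · inv g′) (det-·-1 {g} {inv g′} eg (trans (det-inv g′) eg′)) tr lᵉv≡1
          -- The two eigenvalues differ: otherwise l^(2e) = 1, and the odd order would give lᵉ = 1.
          (λ lᵉ≡v → lᵉ≢1 (odd-order-square n (trans (^-assocʳ l e r) (^-∣ l^r≡1 (divides e refl)))
            (trans (cong (l ^ e *_) lᵉ≡v) lᵉv≡1))))
        where
        v≡mᵉ : v ≡ m ^ e
        v≡mᵉ = *-cancelˡ (l ^ e) _ _ (^-≢0 e (unit-root≢0 {n = r} (s≤s z≤n) l^r≡1)) (trans lᵉv≡1 (sym (l^i*m^i≡1 e)))
        diag≡ : diag (l ^ e) v ≡ pow (diag l m) e
        diag≡ = trans (cong (diag (l ^ e)) v≡mᵉ) (sym (pow-diag l m e))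
        from-diagonalisation : (∃ λ x → det x ≡ 1# × Intertwines x (g · inv g′) (diag (l ^ e) v)) → Intersect g g′
        from-diagonalisation (x , ex , x-diagonalises) = conjugate⇒intersect {x} {g} {g′} e ex
          (subst (Intertwines x (g · inv g′)) diag≡ x-diagonalises)

  -- From the element h to the family.

  -- Order r in PSL only says that the r-th power of h is I or -I in SL. Squaring removes the sign,
  -- which is why the proof diagonalises h² and not h.
  square-has-order : ∀ {h} r → pow h r ≈ I → pow (h · h) r ≡ I
  square-has-order {h} r h^r≈I = trans (pow-square h r) (trans (pow-+ h r r) (square h^r≈I))
    where
    square : ∀ {M} → M ≈ I → M · M ≡ I
    square (inj₁ refl) = ·-identityˡ I
    square (inj₂ refl) = trans (neg-distribˡ-· I (neg I)) (trans (cong neg (·-identityˡ (neg I))) (neg-involutive I))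

  HasIntersectingFamily : Mat → ℕ → Set
  HasIntersectingFamily h r = ∃ λ 𝓕 → All (_∈ SL) 𝓕 × AllPairs (λ g g′ → ¬ g ≈ g′) 𝓕 × AllPairs (Cosets.Intersect h r) 𝓕
    × (3 ℕ.* r ℕ.∸ 1) ℕ.* |G| ℕ.≤ length 𝓕 ℕ.* Cosets.|Ω| h r ℕ.* (2 ℕ.* r)

  module _ (n : ℕ) (h : Mat) (pr : Prime (suc (n ℕ.+ n)))
           (det-h : det h ≡ 1#) (h^r≈I : pow h (suc (n ℕ.+ n)) ≈ I) where

    from-eigenbasis : ∀ l → (l^r≡1 : l ^ suc (n ℕ.+ n) ≡ 1#) → l ≢ 1# →
      (∃ λ y → det y ≡ 1# × Intertwines y (h · h) (diag l (l ^ (n ℕ.+ n)))) → HasIntersectingFamily h (suc (n ℕ.+ n))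
    from-eigenbasis l l^r≡1 l≢1 (y , det-y , y-diagonalises) =
      family l n pr l^r≡1 l≢1 ,
      All.map ∈-SL⁺ dets ,
      AllPairs-map-All (λ {g} {g′} _ eg′ → compatible⇒≉ l n pr l^r≡1 l≢1 {g} {g′} eg′) dets pairs ,
      AllPairs-map-All
        (λ {g} {g′} → compatible⇒intersect l n pr l^r≡1 l≢1 {h} {y} det-h h^r≈I det-y y-diagonalises {g} {g′})
        dets pairs ,
      density-arithmetic n _ |G| (Cosets.|Ω| h (suc (n ℕ.+ n)))
        (length-family l n pr l^r≡1 l≢1) (CyclicSubgroup.|G|≤|Ω|*r h (n ℕ.+ n) det-h h^r≈I)
      where
      dets  = det-family l n pr l^r≡1 l≢1
      pairs = family-compatible l n pr l^r≡1 l≢1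

    from-eigenvalue : (∃ λ l → l ^ suc (n ℕ.+ n) ≡ 1# × l ≢ 1# × trace (h · h) * l ≡ 1# + l * l) →
      HasIntersectingFamily h (suc (n ℕ.+ n))
    from-eigenvalue (l , l^r≡1 , l≢1 , tr) = from-eigenbasis l l^r≡1 l≢1
      (diagonalisable (h · h) {l} {l⁻¹} (det-·-1 {h} {h} det-h det-h) trace≡ l^r≡1 l≢l⁻¹)
      where
      l⁻¹ : Carrier
      l⁻¹ = l ^ (n ℕ.+ n)
      trace≡ : trace (h · h) ≡ l + l⁻¹
      trace≡ = begin
        trace (h · h)                ≡⟨ *-identityʳ _ ⟨
        trace (h · h) * 1#           ≡⟨ cong (trace (h · h) *_) l^r≡1 ⟨
        trace (h · h) * (l * l⁻¹)    ≡⟨ *-assoc _ l l⁻¹ ⟨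
        trace (h · h) * l * l⁻¹      ≡⟨ cong (_* l⁻¹) tr ⟩
        (1# + l * l) * l⁻¹           ≡⟨ solve 2 (λ l k → (:1 :+ l :* l) :* k := l :* (l :* k) :+ k) refl l l⁻¹ ⟩
        l * (l * l⁻¹) + l⁻¹          ≡⟨ cong (λ w → l * w + l⁻¹) l^r≡1 ⟩
        l * 1# + l⁻¹                 ≡⟨ cong (_+ l⁻¹) (*-identityʳ l) ⟩
        l + l⁻¹                      ∎
      l≢l⁻¹ : l ≢ l⁻¹
      l≢l⁻¹ l≡l⁻¹ = l≢1 (odd-order-square n l^r≡1 (trans (cong (l *_) l≡l⁻¹) l^r≡1))

  -- Here `q` is the cofactor (order - 1) / (2r), not the order of the field.
  intersecting-family : ∀ n q h → Prime (suc (n ℕ.+ n)) → order ℕ.∸ 1 ≡ q ℕ.* (2 ℕ.* suc (n ℕ.+ n)) →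
    det h ≡ 1# → HasOrder h (suc (n ℕ.+ n)) → HasIntersectingFamily h (suc (n ℕ.+ n))
  intersecting-family zero      _ _ pr = contradiction pr ¬prime[1]
  intersecting-family n@(suc k) q h pr q-1≡ det-h (h^r≈I , h^k≉I) =
    let ζ , ζ^r≡1 , ζ≢1 = nontrivial-root-of-unity (suc (n ℕ.+ n)) (q ℕ.* 2)
                            (trans q-1≡ (sym (ℕ.*-assoc q 2 _))) (s≤s (s≤s z≤n))
    in from-eigenvalue n h pr det-h h^r≈I
         (eigenvalue {M = h · h} pr ζ^r≡1 ζ≢1 (det-·-1 {h} {h} det-h det-h)
           (square-has-order (suc (n ℕ.+ n)) h^r≈I) h²≢I)
    where
    h²≢I : h · h ≢ I
    -- The minimality in `HasOrder` applies at exponent 2, since n ≥ 1 makes r at least 3.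
    h²≢I h²≡I = h^k≉I 2 (s≤s z≤n) (s≤s (s≤s (ℕ.m≤n⇒m≤o+n k (s≤s z≤n))))
      (inj₁ (trans (cong (h ·_) (·-identityʳ h)) h²≡I))

open import Data.Nat using (_*_; _∸_; _≤_)

theorem4p1 : (F : FiniteField) (r : ℕ) → Prime r → ¬ (2 ∣ r)
    → 2 * r ∣ FiniteField.order F ∸ 1
    → (h : PSL2.Mat F) → PSL2.det F h ≡ FiniteField.1# F → PSL2.HasOrder F h r
    → ∃ λ (𝓕 : List (PSL2.Mat F))
    → All (λ g → g ∈ PSL2.SL F) 𝓕
    × AllPairs (λ g g' → ¬ PSL2._≈_ F g g') 𝓕
    × AllPairs (PSL2.Cosets.Intersect F h r) 𝓕
    × (3 * r ∸ 1) * PSL2.|G| F ≤ length 𝓕 * PSL2.Cosets.|Ω| F h r * (2 * r)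
theorem4p1 F r pr 2∤r (divides q q-1≡) h det-h ord with even-or-odd r
... | inj₁ 2∣r        = contradiction 2∣r 2∤r
... | inj₂ (n , refl) = PSL2Theory.intersecting-family F n q h pr q-1≡ det-h ord
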